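{- For all positive integers $n$, the Boolean-Narayana polynomial $\mathrm{BoNa}_n(u)=\sum_{k=1}^n \mathrm{BoNa}(n,k)u^k$ has real roots only.
   Context: A binary plane tree is a rooted plane tree on unlabeled vertices in which every non-leaf vertex has one or two children, and every child is a left child or a right child, even if it is the only child of its parent. A 0-1-tree is a binary plane tree in which every vertex that has two children is labeled 0 or 1 (no other vertex is labeled). A right edge is an edge connecting a vertex to its right child. For $n\ge 1$, the Boolean-Narayana number $\mathrm{BoNa}(n,k)$ is the number of 0-1-trees on $n$ vertices that have exactly $k-1$ right edges. -}

module Defs where

open import Data.Nat.Base as ℕ using (ℕ; zero; suc; _∸_; s≤s)
import Data.Nat.Properties as ℕ
open import Data.Integer.Base using (+_)
open import Data.Rational.Base as ℚ using (ℚ; 0ℚ; 1ℚ; ½; ∣_∣)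
import Data.Rational.Properties as ℚ
open import Data.Rational.Solver using (module +-*-Solver)
open import Data.Fin.Base using (Fin)
open import Data.List.Base
  using (List; []; _∷_; _++_; length; map; concatMap; cartesianProduct;
         cartesianProductWith; filter; upTo; allFin; applyUpTo; foldr)
open import Data.List.Membership.Propositional using (_∈_)
open import Data.List.Membership.Propositional.Properties
  using (∈-++⁺ˡ; ∈-++⁺ʳ; ∈-++⁻; ∈-map⁺; ∈-map⁻; ∈-concatMap⁺; ∈-concatMap⁻;
         ∈-cartesianProduct⁺; ∈-cartesianProduct⁻; ∈-cartesianProductWith⁺;
         ∈-cartesianProductWith⁻; ∈-upTo⁺; ∈-upTo⁻; ∈-allFin; ∈-filter⁺; ∈-filter⁻)
open import Data.List.Relation.Unary.Any using (here; there)
import Data.List.Relation.Unary.Any as Any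
import Data.List.Relation.Unary.Any.Properties as Any
import Data.List.Relation.Unary.All as All
import Data.List.Relation.Unary.All.Properties as All
import Data.List.Relation.Unary.AllPairs as AllPairs
import Data.List.Relation.Unary.AllPairs.Properties as AllPairs
open import Data.List.Relation.Unary.Unique.Propositional using (Unique)
import Data.List.Relation.Unary.Unique.Propositional.Properties as Unique
open import Data.Product.Base using (∃; _×_; _,_; proj₁; proj₂)
open import Data.Empty using (⊥)
open import Data.Sum.Base using (_⊎_; inj₁; inj₂)
open import Function.Base using (_∘_)
open import Function.Bundles using (_⇔_; mk⇔)
open import Relation.Binary.PropositionalEquality
  using (_≡_; refl; sym; trans; cong; cong₂; subst)

-- 0-1-trees.  The constructors list the possible child patterns of the root:
-- no child, only a left child, only a right child, or both.

data Tree : Set where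
  leaf  : Tree
  left  : Tree → Tree
  right : Tree → Tree
  both  : (label : Fin 2) → Tree → Tree → Tree

vertices : Tree → ℕ
vertices leaf         = 1
vertices (left t)     = suc (vertices t)
vertices (right t)    = suc (vertices t)
vertices (both _ l r) = suc (vertices l ℕ.+ vertices r)

rightEdges : Tree → ℕ
rightEdges leaf         = 0
rightEdges (left t)     = rightEdges t
rightEdges (right t)    = suc (rightEdges t)
rightEdges (both _ l r) = suc (rightEdges l ℕ.+ rightEdges r)

leaves : ℕ → List Tree
leaves zero    = leaf ∷ []
leaves (suc _) = []

bothFrom : List Tree → List Tree → List Tree
bothFrom ls rs =
  cartesianProductWith (λ { a (l , r) → both a l r }) (allFin 2) (cartesianProduct ls rs)

-- The trees with n vertices and at most f levels; the bound f only serves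
-- to make the recursion structural.

enum : (f n : ℕ) → List Tree
enum zero    _       = []
enum (suc f) zero    = []
enum (suc f) (suc m) =
  leaves m ++ map left (enum f m) ++ map right (enum f m) ++
  concatMap (λ i → bothFrom (enum f i) (enum f (m ∸ i))) (upTo (suc m))

trees : ℕ → List Tree
trees n = enum n n

boNaTrees : (n k : ℕ) → List Tree
boNaTrees n k = filter (λ t → suc (rightEdges t) ℕ.≟ k) (trees n)

BoNa : (n k : ℕ) → ℕ
BoNa n k = length (boNaTrees n k)

-- Correctness of the enumeration: boNaTrees n k contains exactly the trees
-- with n vertices and k - 1 right edges, each of them once.

private
  ∈-bothFrom⁻ : ∀ {t} ls rs → t ∈ bothFrom ls rs →
                ∃ λ a → ∃ λ l → ∃ λ r → l ∈ ls × r ∈ rs × t ≡ both a l r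
  ∈-bothFrom⁻ ls rs t∈
    with a , (l , r) , _ , lr∈ , eq ←
           ∈-cartesianProductWith⁻ (λ { a (l , r) → both a l r }) (allFin 2) (cartesianProduct ls rs) t∈
    with l∈ , r∈ ← ∈-cartesianProduct⁻ ls rs lr∈ = a , l , r , l∈ , r∈ , eq

  ∈-bothFrom⁺ : ∀ a {l r ls rs} → l ∈ ls → r ∈ rs → both a l r ∈ bothFrom ls rs
  ∈-bothFrom⁺ a l∈ r∈ =
    ∈-cartesianProductWith⁺ (λ { a (l , r) → both a l r }) (∈-allFin a) (∈-cartesianProduct⁺ l∈ r∈)

  data View (f m : ℕ) : Tree → Set where
    leaf  : m ≡ 0 → View f m leaf
    left  : ∀ {t} → t ∈ enum f m → View f m (left t)
    right : ∀ {t} → t ∈ enum f m → View f m (right t)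
    both  : ∀ {a l r} i → i ℕ.≤ m → l ∈ enum f i → r ∈ enum f (m ∸ i) → View f m (both a l r)

  leaves⁻ : ∀ {f t} m → t ∈ leaves m → View f m t
  leaves⁻ zero (here refl) = leaf refl

  lefts⁻ : ∀ {t} f m → t ∈ map left (enum f m) → View f m t
  lefts⁻ f m t∈ with _ , s∈ , refl ← ∈-map⁻ left t∈ = left s∈

  rights⁻ : ∀ {t} f m → t ∈ map right (enum f m) → View f m t
  rights⁻ f m t∈ with _ , s∈ , refl ← ∈-map⁻ right t∈ = right s∈

  bothBlock : (f m i : ℕ) → List Tree
  bothBlock f m i = bothFrom (enum f i) (enum f (m ∸ i))

  bothBlocks : (f m : ℕ) → List Tree
  bothBlocks f m = concatMap (bothBlock f m) (upTo (suc m))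

  findUpTo : ∀ {P : ℕ → Set} n → Any.Any P (upTo n) → ∃ λ i → i ℕ.< n × P i
  findUpTo n p = Any.applyUpTo⁻ (λ i → i) p

  boths⁻ : ∀ {t} f m → t ∈ bothBlocks f m → View f m t
  boths⁻ f m t∈
    with i , s≤s i≤m , t∈′ ← findUpTo (suc m) (∈-concatMap⁻ (bothBlock f m) {xs = upTo (suc m)} t∈)
    with _ , _ , _ , l∈ , r∈ , refl ← ∈-bothFrom⁻ (enum f i) (enum f (m ∸ i)) t∈′
    = both i i≤m l∈ r∈

  view : ∀ {t} f m → t ∈ enum (suc f) (suc m) → View f m t
  view f m t∈ with ∈-++⁻ (leaves m) t∈
  ... | inj₁ p = leaves⁻ m p
  ... | inj₂ p with ∈-++⁻ (map left (enum f m)) p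
  ...   | inj₁ q = lefts⁻ f m q
  ...   | inj₂ q with ∈-++⁻ (map right (enum f m)) q
  ...     | inj₁ r = rights⁻ f m r
  ...     | inj₂ r = boths⁻ f m r

  ∈-enum⁻ : ∀ f n {t} → t ∈ enum f n → vertices t ≡ n
  ∈-enum⁻ (suc f) (suc m) t∈ with view f m t∈
  ... | leaf refl      = refl
  ... | left s∈        = cong suc (∈-enum⁻ f m s∈)
  ... | right s∈       = cong suc (∈-enum⁻ f m s∈)
  ... | both i i≤m l∈ r∈ =
    cong suc (trans (cong₂ ℕ._+_ (∈-enum⁻ f i l∈) (∈-enum⁻ f (m ∸ i) r∈)) (ℕ.m+[n∸m]≡n i≤m))

  ∈-enum⁺ : ∀ f t → vertices t ℕ.≤ f → t ∈ enum f (vertices t)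
  ∈-enum⁺ (suc f) leaf      _       = here refl
  ∈-enum⁺ (suc f) (left t)  (s≤s p) =
    ∈-++⁺ʳ (leaves (vertices t)) (∈-++⁺ˡ (∈-map⁺ left (∈-enum⁺ f t p)))
  ∈-enum⁺ (suc f) (right t) (s≤s p) =
    ∈-++⁺ʳ (leaves (vertices t)) (∈-++⁺ʳ (map left (enum f (vertices t)))
      (∈-++⁺ˡ (∈-map⁺ right (∈-enum⁺ f t p))))
  ∈-enum⁺ (suc f) (both a l r) (s≤s p) =
    ∈-++⁺ʳ (leaves m) (∈-++⁺ʳ (map left (enum f m)) (∈-++⁺ʳ (map right (enum f m))
      (∈-concatMap⁺ (bothBlock f m) {xs = upTo (suc m)}
        (Any.applyUpTo⁺ (λ i → i) block (s≤s (ℕ.m≤m+n (vertices l) (vertices r)))))))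
    where
    m = vertices l ℕ.+ vertices r
    block : both a l r ∈ bothBlock f m (vertices l)
    block = ∈-bothFrom⁺ a
      (∈-enum⁺ f l (ℕ.≤-trans (ℕ.m≤m+n (vertices l) (vertices r)) p))
      (subst (λ j → r ∈ enum f j) (sym (ℕ.m+n∸m≡n (vertices l) (vertices r)))
        (∈-enum⁺ f r (ℕ.≤-trans (ℕ.m≤n+m (vertices r) (vertices l)) p)))

  leaves-unique : ∀ m → Unique (leaves m)
  leaves-unique zero    = All.[] AllPairs.∷ AllPairs.[]
  leaves-unique (suc _) = AllPairs.[]

  bothFrom-unique : ∀ {ls rs} → Unique ls → Unique rs → Unique (bothFrom ls rs)
  bothFrom-unique ul ur =
    Unique.cartesianProductWith⁺ (λ { a (l , r) → both a l r }) (λ { refl → refl , refl })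
      (Unique.allFin⁺ 2) (Unique.cartesianProduct⁺ ul ur)

  enum-unique : ∀ f n → Unique (enum f n)
  enum-unique zero    n       = AllPairs.[]
  enum-unique (suc f) zero    = AllPairs.[]
  enum-unique (suc f) (suc m) =
    Unique.++⁺ (leaves-unique m)
      (Unique.++⁺ (Unique.map⁺ (λ { refl → refl }) (enum-unique f m))
        (Unique.++⁺ (Unique.map⁺ (λ { refl → refl }) (enum-unique f m))
          boths-unique
          (λ { (p , q) → right≢both p q }))
        (λ { (p , q) → left≢ p (∈-++⁻ (map right (enum f m)) q) }))
      (λ { (p , q) → leaf≢ m p q })
    where
    boths-shape : ∀ {t} → t ∈ bothBlocks f m → ∃ λ a → ∃ λ l → ∃ λ r → t ≡ both a l r
    boths-shape p
      with i , _ , q ← findUpTo (suc m) (∈-concatMap⁻ (bothBlock f m) {xs = upTo (suc m)} p)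
      with a , l , r , _ , _ , eq ← ∈-bothFrom⁻ (enum f i) (enum f (m ∸ i)) q = a , l , r , eq

    right≢both : ∀ {t} → t ∈ map right (enum f m) → t ∈ bothBlocks f m → ⊥
    right≢both p q with _ , _ , refl ← ∈-map⁻ right p with _ , _ , _ , () ← boths-shape q

    left≢ : ∀ {t} → t ∈ map left (enum f m) →
            t ∈ map right (enum f m) ⊎ t ∈ bothBlocks f m → ⊥
    left≢ p (inj₁ q) with _ , _ , refl ← ∈-map⁻ left p with _ , _ , () ← ∈-map⁻ right q
    left≢ p (inj₂ q) with _ , _ , refl ← ∈-map⁻ left p with _ , _ , _ , () ← boths-shape q

    leaf≢ : ∀ {t} k → t ∈ leaves k →
            t ∈ map left (enum f m) ++ map right (enum f m) ++ bothBlocks f m → ⊥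
    leaf≢ zero (here refl) q with ∈-++⁻ (map left (enum f m)) q
    ... | inj₁ r with _ , _ , () ← ∈-map⁻ left r
    leaf≢ zero (here refl) q | inj₂ r with ∈-++⁻ (map right (enum f m)) r
    ... | inj₁ s with _ , _ , () ← ∈-map⁻ right s
    ... | inj₂ s with _ , _ , _ , () ← boths-shape s

    disjoint : ∀ {i j t} → i ℕ.< j → t ∈ bothBlock f m i × t ∈ bothBlock f m j → ⊥
    disjoint {i} {j} i<j (p , q)
      with _ , _ , _ , l∈ , _ , refl ← ∈-bothFrom⁻ (enum f i) (enum f (m ∸ i)) p
      with _ , _ , _ , l∈′ , _ , refl ← ∈-bothFrom⁻ (enum f j) (enum f (m ∸ j)) q
      = ℕ.<⇒≢ i<j (trans (sym (∈-enum⁻ f i l∈)) (∈-enum⁻ f j l∈′))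

    boths-unique : Unique (bothBlocks f m)
    boths-unique = Unique.concat⁺
      (All.map⁺ (All.applyUpTo⁺₂ (λ i → i) (suc m)
        (λ i → bothFrom-unique (enum-unique f i) (enum-unique f (m ∸ i)))))
      (AllPairs.map⁺ (AllPairs.applyUpTo⁺₁ (λ i → i) (suc m) (λ i<j _ → disjoint i<j)))

∈-boNaTrees : ∀ n k t → t ∈ boNaTrees n k ⇔ (vertices t ≡ n × suc (rightEdges t) ≡ k)
∈-boNaTrees n k t = mk⇔
  (λ p → let q , e = ∈-filter⁻ (λ t → suc (rightEdges t) ℕ.≟ k) {xs = trees n} p
         in ∈-enum⁻ n n q , e)
  (λ { (refl , e) →
       ∈-filter⁺ (λ t → suc (rightEdges t) ℕ.≟ k) (∈-enum⁺ n t ℕ.≤-refl) e })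

boNaTrees-unique : ∀ n k → Unique (boNaTrees n k)
boNaTrees-unique n k = Unique.filter⁺ (λ t → suc (rightEdges t) ℕ.≟ k) (enum-unique n n)

-- Real numbers are Cauchy sequences of rationals, considered up to _≃_
-- (the difference tends to 0).

Cauchy : (ℕ → ℚ) → Set
Cauchy x = ∀ ε → 0ℚ ℚ.< ε → ∃ λ N → ∀ m n → N ℕ.≤ m → N ℕ.≤ n → ∣ x m ℚ.- x n ∣ ℚ.< ε

record ℝ : Set where
  constructor mkℝ
  field
    seq    : ℕ → ℚ
    cauchy : Cauchy seq

open ℝ public

infix 4 _≃_
_≃_ : ℝ → ℝ → Set
x ≃ y = ∀ ε → 0ℚ ℚ.< ε → ∃ λ N → ∀ n → N ℕ.≤ n → ∣ seq x n ℚ.- seq y n ∣ ℚ.< ε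

private
  -- Only the existence of the moduli matters, so they are kept from unfolding.
  abstract
    const-cauchy : ∀ q → Cauchy (λ _ → q)
    const-cauchy q ε ε>0 = 0 , λ _ _ _ _ →
      subst (λ d → ∣ d ∣ ℚ.< ε) (sym (ℚ.+-inverseʳ q)) ε>0

    half>0 : ∀ {ε} → 0ℚ ℚ.< ε → 0ℚ ℚ.< ½ ℚ.* ε
    half>0 {ε} ε>0 = ℚ.positive⁻¹ (½ ℚ.* ε) {{ℚ.pos*pos⇒pos ½ ε {{ℚ.positive ε>0}}}}

    halves : ∀ ε → ½ ℚ.* ε ℚ.+ ½ ℚ.* ε ≡ ε
    halves ε = trans (sym (ℚ.*-distribʳ-+ ε ½ ½)) (ℚ.*-identityˡ ε)

    +-cauchy : ∀ {x y} → Cauchy x → Cauchy y → Cauchy (λ n → x n ℚ.+ y n)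
    +-cauchy {x} {y} cx cy ε ε>0
      with M , hx ← cx (½ ℚ.* ε) (half>0 ε>0)
      with N , hy ← cy (½ ℚ.* ε) (half>0 ε>0)
      = M ℕ.⊔ N , λ m n p q → begin-strict
        ∣ (x m ℚ.+ y m) ℚ.- (x n ℚ.+ y n) ∣
          ≡⟨ cong ∣_∣ (regroup (x m) (y m) (x n) (y n)) ⟩
        ∣ (x m ℚ.- x n) ℚ.+ (y m ℚ.- y n) ∣
          ≤⟨ ℚ.∣p+q∣≤∣p∣+∣q∣ (x m ℚ.- x n) (y m ℚ.- y n) ⟩
        ∣ x m ℚ.- x n ∣ ℚ.+ ∣ y m ℚ.- y n ∣
          <⟨ ℚ.+-mono-< (hx m n (ℕ.m⊔n≤o⇒m≤o M N p) (ℕ.m⊔n≤o⇒m≤o M N q))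
                        (hy m n (ℕ.m⊔n≤o⇒n≤o M N p) (ℕ.m⊔n≤o⇒n≤o M N q)) ⟩
        ½ ℚ.* ε ℚ.+ ½ ℚ.* ε
          ≡⟨ halves ε ⟩
        ε ∎
      where
      open ℚ.≤-Reasoning
      open +-*-Solver
      regroup : ∀ a b c d → (a ℚ.+ b) ℚ.- (c ℚ.+ d) ≡ (a ℚ.- c) ℚ.+ (b ℚ.- d)
      regroup = solve 4 (λ a b c d → (a :+ b) :- (c :+ d) := (a :- c) :+ (b :- d)) refl

    neg-cauchy : ∀ {x} → Cauchy x → Cauchy (λ n → ℚ.- x n)
    neg-cauchy {x} cx ε ε>0 with N , h ← cx ε ε>0 = N , λ m n p q →
      subst (ℚ._< ε) (trans (sym (ℚ.∣-p∣≡∣p∣ (x m ℚ.- x n))) (cong ∣_∣ (ℚ.neg-distrib-+ (x m) (ℚ.- x n))))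
        (h m n p q)

    0<1 : 0ℚ ℚ.< 1ℚ
    0<1 = ℚ.positive⁻¹ 1ℚ

    bounded : ∀ {x} → Cauchy x →
              ∃ λ N → ∃ λ B → 0ℚ ℚ.< B × (∀ n → N ℕ.≤ n → ∣ x n ∣ ℚ.≤ B)
    bounded {x} cx with N , h ← cx 1ℚ 0<1 =
      N , 1ℚ ℚ.+ ∣ x N ∣ , ℚ.+-mono-<-≤ 0<1 (ℚ.0≤∣p∣ (x N)) , λ n p → begin
        ∣ x n ∣                        ≡⟨ cong ∣_∣ (split (x n) (x N)) ⟩
        ∣ (x n ℚ.- x N) ℚ.+ x N ∣      ≤⟨ ℚ.∣p+q∣≤∣p∣+∣q∣ (x n ℚ.- x N) (x N) ⟩
        ∣ x n ℚ.- x N ∣ ℚ.+ ∣ x N ∣    ≤⟨ ℚ.+-monoˡ-≤ ∣ x N ∣ (ℚ.<⇒≤ (h n N p ℕ.≤-refl)) ⟩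
        1ℚ ℚ.+ ∣ x N ∣                 ∎
      where
      open ℚ.≤-Reasoning
      open +-*-Solver
      split : ∀ a b → a ≡ (a ℚ.- b) ℚ.+ b
      split = solve 2 (λ a b → a := (a :- b) :+ b) refl

    share : ∀ {D ε} → 0ℚ ℚ.< D → 0ℚ ℚ.< ε → ∃ λ δ → 0ℚ ℚ.< δ × D ℚ.* δ ≡ ε
    share {D} {ε} D>0 ε>0 = D⁻¹ ℚ.* ε , ℚ.positive⁻¹ (D⁻¹ ℚ.* ε) {{δ-pos}} , eq
      where
      instance
        D-pos : ℚ.Positive D
        D-pos = ℚ.positive D>0
        D-nz : ℚ.NonZero D
        D-nz = ℚ.pos⇒nonZero D
      D⁻¹ : ℚ
      D⁻¹ = ℚ.1/ D
      δ-pos : ℚ.Positive (D⁻¹ ℚ.* ε)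
      δ-pos = ℚ.pos*pos⇒pos D⁻¹ {{ℚ.1/pos⇒pos D}} ε {{ℚ.positive ε>0}}
      eq : D ℚ.* (D⁻¹ ℚ.* ε) ≡ ε
      eq = trans (sym (ℚ.*-assoc D D⁻¹ ε))
        (trans (cong (ℚ._* ε) (ℚ.*-inverseʳ D)) (ℚ.*-identityˡ ε))

    product-bound : ∀ a b {A δ} → 0ℚ ℚ.< A → ∣ a ∣ ℚ.≤ A → ∣ b ∣ ℚ.< δ → ∣ a ℚ.* b ∣ ℚ.< A ℚ.* δ
    product-bound a b {A} {δ} A>0 a≤A b<δ = begin-strict
      ∣ a ℚ.* b ∣      ≡⟨ ℚ.∣p*q∣≡∣p∣*∣q∣ a b ⟩
      ∣ a ∣ ℚ.* ∣ b ∣  ≤⟨ ℚ.*-monoʳ-≤-nonNeg ∣ b ∣ {{ℚ.∣-∣-nonNeg b}} a≤A ⟩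
      A ℚ.* ∣ b ∣      <⟨ ℚ.*-monoʳ-<-pos A {{ℚ.positive A>0}} b<δ ⟩
      A ℚ.* δ          ∎
      where open ℚ.≤-Reasoning

    product-difference : ∀ {a b c d A B δ} → 0ℚ ℚ.< A → 0ℚ ℚ.< B → ∣ a ∣ ℚ.≤ A → ∣ d ∣ ℚ.≤ B →
      ∣ b ℚ.- d ∣ ℚ.< δ → ∣ a ℚ.- c ∣ ℚ.< δ → ∣ a ℚ.* b ℚ.- c ℚ.* d ∣ ℚ.< (A ℚ.+ B) ℚ.* δ
    product-difference {a} {b} {c} {d} {A} {B} {δ} A>0 B>0 a≤A d≤B b-d<δ a-c<δ = begin-strict
      ∣ a ℚ.* b ℚ.- c ℚ.* d ∣
        ≡⟨ cong ∣_∣ (regroup a b c d) ⟩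
      ∣ a ℚ.* (b ℚ.- d) ℚ.+ d ℚ.* (a ℚ.- c) ∣
        ≤⟨ ℚ.∣p+q∣≤∣p∣+∣q∣ (a ℚ.* (b ℚ.- d)) (d ℚ.* (a ℚ.- c)) ⟩
      ∣ a ℚ.* (b ℚ.- d) ∣ ℚ.+ ∣ d ℚ.* (a ℚ.- c) ∣
        <⟨ ℚ.+-mono-< (product-bound a (b ℚ.- d) A>0 a≤A b-d<δ)
                      (product-bound d (a ℚ.- c) B>0 d≤B a-c<δ) ⟩
      A ℚ.* δ ℚ.+ B ℚ.* δ
        ≡⟨ sym (ℚ.*-distribʳ-+ δ A B) ⟩
      (A ℚ.+ B) ℚ.* δ ∎
      where
      open ℚ.≤-Reasoning
      open +-*-Solver
      regroup : ∀ a b c d → a ℚ.* b ℚ.- c ℚ.* d ≡ a ℚ.* (b ℚ.- d) ℚ.+ d ℚ.* (a ℚ.- c)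
      regroup = solve 4 (λ a b c d → a :* b :- c :* d := a :* (b :- d) :+ d :* (a :- c)) refl

    *-cauchy : ∀ {x y} → Cauchy x → Cauchy y → Cauchy (λ n → x n ℚ.* y n)
    *-cauchy {x} {y} cx cy ε ε>0 =
      let K , B , B>0 , hB = bounded cx
          L , C , C>0 , hC = bounded cy
          δ , δ>0 , eq     = share (ℚ.+-mono-< B>0 C>0) ε>0
          M , hx           = cx δ δ>0
          N , hy           = cy δ δ>0
      in (M ℕ.⊔ N) ℕ.⊔ (K ℕ.⊔ L) , λ m n p q →
        let p₁ = ℕ.m⊔n≤o⇒m≤o (M ℕ.⊔ N) (K ℕ.⊔ L) p
            p₂ = ℕ.m⊔n≤o⇒n≤o (M ℕ.⊔ N) (K ℕ.⊔ L) p
            q₁ = ℕ.m⊔n≤o⇒m≤o (M ℕ.⊔ N) (K ℕ.⊔ L) q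
            q₂ = ℕ.m⊔n≤o⇒n≤o (M ℕ.⊔ N) (K ℕ.⊔ L) q
        in subst (∣ x m ℚ.* y m ℚ.- x n ℚ.* y n ∣ ℚ.<_) eq
          (product-difference {x m} {y m} {x n} {y n} B>0 C>0
            (hB m (ℕ.m⊔n≤o⇒m≤o K L p₂)) (hC n (ℕ.m⊔n≤o⇒n≤o K L q₂))
            (hy m n (ℕ.m⊔n≤o⇒n≤o M N p₁) (ℕ.m⊔n≤o⇒n≤o M N q₁))
            (hx m n (ℕ.m⊔n≤o⇒m≤o M N p₁) (ℕ.m⊔n≤o⇒m≤o M N q₁)))

fromℚ : ℚ → ℝ
fromℚ q = mkℝ (λ _ → q) (const-cauchy q)

fromℕ : ℕ → ℝ
fromℕ n = fromℚ (+ n ℚ./ 1)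

0ℝ : ℝ
0ℝ = fromℚ 0ℚ

infixl 6 _+ℝ_ _-ℝ_
infixl 7 _*ℝ_
infix  8 -ℝ_

_+ℝ_ : ℝ → ℝ → ℝ
mkℝ x cx +ℝ mkℝ y cy = mkℝ (λ n → x n ℚ.+ y n) (+-cauchy {x} {y} cx cy)

-ℝ_ : ℝ → ℝ
-ℝ mkℝ x cx = mkℝ (λ n → ℚ.- x n) (neg-cauchy {x} cx)

_-ℝ_ : ℝ → ℝ → ℝ
x -ℝ y = x +ℝ (-ℝ y)

_*ℝ_ : ℝ → ℝ → ℝ
mkℝ x cx *ℝ mkℝ y cy = mkℝ (λ n → x n ℚ.* y n) (*-cauchy {x} {y} cx cy)

record ℂ : Set where
  constructor _+i_
  field
    re im : ℝ

open ℂ public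

infix 4 _≃ℂ_
_≃ℂ_ : ℂ → ℂ → Set
z ≃ℂ w = re z ≃ re w × im z ≃ im w

ofℝ : ℝ → ℂ
ofℝ x = x +i 0ℝ

infixl 6 _+ℂ_
infixl 7 _*ℂ_

_+ℂ_ : ℂ → ℂ → ℂ
(a +i b) +ℂ (c +i d) = (a +ℝ c) +i (b +ℝ d)

_*ℂ_ : ℂ → ℂ → ℂ
(a +i b) *ℂ (c +i d) = ((a *ℝ c) -ℝ (b *ℝ d)) +i ((a *ℝ d) +ℝ (b *ℝ c))

-- A real polynomial is its list of coefficients, constant term first.

Poly : Set
Poly = List ℝ

eval : Poly → ℂ → ℂ
eval p z = foldr (λ c acc → ofℝ c +ℂ z *ℂ acc) (ofℝ 0ℝ) p

-- Every complex root is a real number.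

RealRootsOnly : Poly → Set
RealRootsOnly p = ∀ z → eval p z ≃ℂ ofℝ 0ℝ → ∃ λ x → z ≃ℂ ofℝ x

BoNaPoly : ℕ → Poly
BoNaPoly n = 0ℝ ∷ applyUpTo (λ i → fromℕ (BoNa n (suc i))) n

{-# OPTIONS --safe #-}
module Submission where

open import Defs
open import Data.Nat.Base using (ℕ; _≤_)

import Algebra.Definitions.RawMonoid
import Algebra.Properties.Semiring.Exp
import Algebra.Solver.Ring.AlmostCommutativeRing as ACR
import Algebra.Solver.Ring.Simple
open import Algebra.Bundles using (CommutativeRing)
open import Data.Bool.Base using (true; false; if_then_else_)
open import Data.Fin.Base using (Fin; zero; suc)
open import Data.Integer.Base as ℤ using (+_)
import Data.Integer.Properties as ℤ
open import Data.List.Base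
  using (List; []; _∷_; _++_; map; concatMap; cartesianProduct; filter; length; applyUpTo)
open import Data.List.Membership.Propositional using (_∈_)
open import Data.List.Membership.Propositional.Properties using (∈-filter⁺)
open import Data.List.Properties using (map-++)
open import Data.List.Relation.Unary.All as All using (All; []; _∷_)
open import Data.Nat.Base as ℕ using (zero; suc; z≤n; s≤s; _∸_)
import Data.Nat.Properties as ℕ
open import Data.Product.Base using (∃; _×_; _,_; proj₁; proj₂)
open import Data.Product.Properties using (≡-dec)
open import Data.Rational.Base as ℚ using (ℚ; 0ℚ; 1ℚ; ½; _+_; _*_; -_; _-_; ∣_∣)
import Data.Rational.Properties as ℚ
import Data.Rational.Solver
open import Data.Rational.Unnormalised.Base as ℚᵘ using (mkℚᵘ; *≡*)
import Data.Rational.Unnormalised.Properties as ℚᵘ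
open import Data.Sum.Base using (inj₁; inj₂)
open import Function.Base using (_∘_)
open import Function.Bundles using (Equivalence)
open import Level using (0ℓ)
open import Relation.Binary.PropositionalEquality
open import Relation.Nullary.Decidable using (decidable-stable)

-- Let a m be the sum of w ^ rightEdges over the trees with m edges, so that BoNaPoly (m + 1) at w
-- is w * a m.  Splitting a tree at its root makes a the Motzkin-type sequence with weights
-- b = 1 + w and c = 2w, and differentiating the quadratic equation of its generating function gives
--   (m + 4) a (m + 2) = (2m + 5) b a (m + 1) - (m + 1) D a m,    D = b² - 4c.
-- For w non-real D/b² is not a nonnegative real, so the convex cone spanned by 1 and -D/b² is a
-- sector of angle less than π; it is stable under r ↦ -(D/b²)/r, hence it contains all the ratios
-- a (m + 1) / (b (a m)), and the coefficient of 1 stays at least 1.  This bounds |a (m + 1) / a m|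
-- away from 0 in terms of a lower bound on |Im w| and an upper bound on |w| only.  All of this
-- happens at rational w, and is applied to the rational approximations of a complex root.

-- Gaussian rationals

module ℚ-Solver = Data.Rational.Solver.+-*-Solver

ℚ[i] : Set
ℚ[i] = ℚ × ℚ

infixl 6 _⊕_
infixl 7 _⊙_
infix  8 ⊖_

_⊕_ _⊙_ : ℚ[i] → ℚ[i] → ℚ[i]
(a , b) ⊕ (c , d) = a + c , b + d
(a , b) ⊙ (c , d) = a * c - b * d , a * d + b * c

⊖_ conj : ℚ[i] → ℚ[i]
⊖ (a , b) = - a , - b
conj (a , b) = a , - b

ι : ℚ → ℚ[i]
ι a = a , 0ℚ

norm : ℚ[i] → ℚ
norm (a , b) = a * a + b * b

⊙-comm : ∀ z w → z ⊙ w ≡ w ⊙ z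
⊙-comm (a , b) (c , d) = cong₂ _,_
  (solve 4 (λ a b c d → a :* c :- b :* d := c :* a :- d :* b) refl a b c d)
  (solve 4 (λ a b c d → a :* d :+ b :* c := c :* b :+ d :* a) refl a b c d)
  where open ℚ-Solver

⊙-assoc : ∀ z w v → (z ⊙ w) ⊙ v ≡ z ⊙ (w ⊙ v)
⊙-assoc (a , b) (c , d) (e , f) = cong₂ _,_
  (solve 6 (λ a b c d e f → (a :* c :- b :* d) :* e :- (a :* d :+ b :* c) :* f
      := a :* (c :* e :- d :* f) :- b :* (c :* f :+ d :* e)) refl a b c d e f)
  (solve 6 (λ a b c d e f → (a :* c :- b :* d) :* f :+ (a :* d :+ b :* c) :* e
      := a :* (c :* f :+ d :* e) :+ b :* (c :* e :- d :* f)) refl a b c d e f)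
  where open ℚ-Solver

⊙-distribˡ-⊕ : ∀ z w v → z ⊙ (w ⊕ v) ≡ (z ⊙ w) ⊕ (z ⊙ v)
⊙-distribˡ-⊕ (a , b) (c , d) (e , f) = cong₂ _,_
  (solve 6 (λ a b c d e f → a :* (c :+ e) :- b :* (d :+ f)
      := (a :* c :- b :* d) :+ (a :* e :- b :* f)) refl a b c d e f)
  (solve 6 (λ a b c d e f → a :* (d :+ f) :+ b :* (c :+ e)
      := (a :* d :+ b :* c) :+ (a :* f :+ b :* e)) refl a b c d e f)
  where open ℚ-Solver

⊙-identityˡ : ∀ z → ι 1ℚ ⊙ z ≡ z
⊙-identityˡ (a , b) = cong₂ _,_
  (solve 2 (λ a b → con 1ℚ :* a :- con 0ℚ :* b := a) refl a b)
  (solve 2 (λ a b → con 1ℚ :* b :+ con 0ℚ :* a := b) refl a b)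
  where open ℚ-Solver

ℚ[i]-commutativeRing : CommutativeRing 0ℓ 0ℓ
ℚ[i]-commutativeRing = record
  { Carrier = ℚ[i] ; _≈_ = _≡_ ; _+_ = _⊕_ ; _*_ = _⊙_ ; -_ = ⊖_ ; 0# = ι 0ℚ ; 1# = ι 1ℚ
  ; isCommutativeRing = record
    { isRing = record
      { +-isAbelianGroup = record
        { isGroup = record
          { isMonoid = record
            { isSemigroup = record
              { isMagma = record { isEquivalence = isEquivalence ; ∙-cong = cong₂ _⊕_ }
              ; assoc = λ (a , b) (c , d) (e , f) → cong₂ _,_ (ℚ.+-assoc a c e) (ℚ.+-assoc b d f)
              }
            ; identity = (λ (a , b) → cong₂ _,_ (ℚ.+-identityˡ a) (ℚ.+-identityˡ b))
                       , (λ (a , b) → cong₂ _,_ (ℚ.+-identityʳ a) (ℚ.+-identityʳ b))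
            }
          ; inverse = (λ (a , b) → cong₂ _,_ (ℚ.+-inverseˡ a) (ℚ.+-inverseˡ b))
                    , (λ (a , b) → cong₂ _,_ (ℚ.+-inverseʳ a) (ℚ.+-inverseʳ b))
          ; ⁻¹-cong = cong ⊖_
          }
        ; comm = λ (a , b) (c , d) → cong₂ _,_ (ℚ.+-comm a c) (ℚ.+-comm b d)
        }
      ; *-cong = cong₂ _⊙_
      ; *-assoc = ⊙-assoc
      ; *-identity = ⊙-identityˡ , λ z → trans (⊙-comm z (ι 1ℚ)) (⊙-identityˡ z)
      ; distrib = ⊙-distribˡ-⊕
                , λ z w v → trans (⊙-comm (w ⊕ v) z)
                    (trans (⊙-distribˡ-⊕ z w v) (cong₂ _⊕_ (⊙-comm z w) (⊙-comm z v)))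
      }
    ; *-comm = ⊙-comm
    }
  }

module ℚ[i]-Solver =
  Algebra.Solver.Ring.Simple (ACR.fromCommutativeRing ℚ[i]-commutativeRing) (≡-dec ℚ._≟_ ℚ._≟_)

open Algebra.Definitions.RawMonoid ℚ.+-0-rawMonoid using () renaming (_×_ to _·_)
open Algebra.Properties.Semiring.Exp (CommutativeRing.semiring ℚ[i]-commutativeRing)
  using (_^_; ^-homo-*)
open Algebra.Properties.Semiring.Exp (CommutativeRing.semiring ℚ.+-*-commutativeRing)
  using () renaming (_^_ to _^ℚ_)

-- Power series over ℚ[i], as coefficient sequences

0ℂ 1ℂ : ℚ[i]
0ℂ = ι 0ℚ
1ℂ = ι 1ℚ

-- `suc n · 1ℚ` unfolds to `1ℚ + n · 1ℚ`, so `ν (suc n)` computes to `1ℂ ⊕ ν n`; the solver calls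
-- below rely on this to relate successive indices.
ν : ℕ → ℚ[i]
ν n = ι (n · 1ℚ)

conv : (ℕ → ℚ[i]) → (ℕ → ℚ[i]) → ℕ → ℚ[i]
conv f g zero    = f 0 ⊙ g 0
conv f g (suc n) = f 0 ⊙ g (suc n) ⊕ conv (f ∘ suc) g n

-- `conv` splits off the first coefficient of `f`; splitting off that of `g` instead is what
-- commutativity and multiplication by X need.
conv-last : ∀ f g n → conv f g (suc n) ≡ conv f (g ∘ suc) n ⊕ f (suc n) ⊙ g 0
conv-last f g zero    = refl
conv-last f g (suc n) = trans (cong (f 0 ⊙ g (suc (suc n)) ⊕_) (conv-last (f ∘ suc) g n))
  (solve 3 (λ x y z → x :+ (y :+ z) := x :+ y :+ z) refl (f 0 ⊙ g (suc (suc n)))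
    (conv (f ∘ suc) (g ∘ suc) n) (f (suc (suc n)) ⊙ g 0))
  where open ℚ[i]-Solver

conv-comm : ∀ f g n → conv f g n ≡ conv g f n
conv-comm f g zero    = ⊙-comm (f 0) (g 0)
conv-comm f g (suc n) = trans (cong (f 0 ⊙ g (suc n) ⊕_) (conv-comm (f ∘ suc) g n))
  (trans (solve 3 (λ x y z → x :* y :+ z := z :+ y :* x) refl (f 0) (g (suc n)) (conv g (f ∘ suc) n))
    (sym (conv-last g f n)))
  where open ℚ[i]-Solver

conv-cong : ∀ n {f f′ g g′} → (∀ i → i ≤ n → f i ≡ f′ i) → (∀ i → i ≤ n → g i ≡ g′ i) →
            conv f g n ≡ conv f′ g′ n
conv-cong zero    p q = cong₂ _⊙_ (p 0 z≤n) (q 0 z≤n)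
conv-cong (suc n) p q = cong₂ _⊕_ (cong₂ _⊙_ (p 0 z≤n) (q (suc n) ℕ.≤-refl))
  (conv-cong n (λ i i≤n → p (suc i) (s≤s i≤n)) (λ i i≤n → q i (ℕ.m≤n⇒m≤1+n i≤n)))

conv-⊕ : ∀ f g h n → conv f (λ i → g i ⊕ h i) n ≡ conv f g n ⊕ conv f h n
conv-⊕ f g h zero    = ⊙-distribˡ-⊕ (f 0) (g 0) (h 0)
conv-⊕ f g h (suc n) = trans (cong (f 0 ⊙ (g (suc n) ⊕ h (suc n)) ⊕_) (conv-⊕ (f ∘ suc) g h n))
  (solve 5 (λ x y z u v → x :* (y :+ z) :+ (u :+ v) := (x :* y :+ u) :+ (x :* z :+ v)) refl
    (f 0) (g (suc n)) (h (suc n)) (conv (f ∘ suc) g n) (conv (f ∘ suc) h n))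
  where open ℚ[i]-Solver

conv-⊙ : ∀ c d f g n → conv (λ i → c ⊙ f i) (λ i → d ⊙ g i) n ≡ (c ⊙ d) ⊙ conv f g n
conv-⊙ c d f g zero    =
  solve 4 (λ c d x y → (c :* x) :* (d :* y) := (c :* d) :* (x :* y)) refl c d (f 0) (g 0)
  where open ℚ[i]-Solver
conv-⊙ c d f g (suc n) =
  trans (cong (c ⊙ f 0 ⊙ (d ⊙ g (suc n)) ⊕_) (conv-⊙ c d (f ∘ suc) g n))
    (solve 5 (λ c d x y z → (c :* x) :* (d :* y) :+ (c :* d) :* z := (c :* d) :* (x :* y :+ z))
      refl c d (f 0) (g (suc n)) (conv (f ∘ suc) g n))
  where open ℚ[i]-Solver

conv-⊙ʳ : ∀ c f g n → conv f (λ i → c ⊙ g i) n ≡ c ⊙ conv f g n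
conv-⊙ʳ c f g n = trans (conv-cong n (λ i _ → sym (⊙-identityˡ (f i))) (λ _ _ → refl))
  (trans (conv-⊙ 1ℂ c f g n) (cong (_⊙ conv f g n) (⊙-identityˡ c)))

-- Multiplication by X.
shift : (ℕ → ℚ[i]) → ℕ → ℚ[i]
shift f zero    = 0ℂ
shift f (suc n) = f n

conv-shift : ∀ f g n → conv f (shift g) n ≡ shift (conv f g) n
conv-shift f g zero    = solve 1 (λ x → x :* con 0ℂ := con 0ℂ) refl (f 0)
  where open ℚ[i]-Solver
conv-shift f g (suc n) = trans (conv-last f (shift g) n)
  (solve 2 (λ x y → x :+ y :* con 0ℂ := x) refl (conv f g n) (f (suc n)))
  where open ℚ[i]-Solver

-- The derivation X d/dX, which unlike d/dX keeps every index in place.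
θ : (ℕ → ℚ[i]) → ℕ → ℚ[i]
θ f n = ν n ⊙ f n

-- The Leibniz rule. In the inductive step the tail of `θ f` differs from `θ` of the tail of `f` by
-- the tail itself, which supplies the extra 1 in `ν (suc n)`.
conv-θ : ∀ f g n → conv (θ f) g n ⊕ conv f (θ g) n ≡ ν n ⊙ conv f g n
conv-θ f g zero    =
  solve 2 (λ x y → con 0ℂ :* x :* y :+ x :* (con 0ℂ :* y) := con 0ℂ :* (x :* y)) refl (f 0) (g 0)
  where open ℚ[i]-Solver
conv-θ f g (suc n) = begin
  (0ℂ ⊙ f 0 ⊙ g (suc n) ⊕ conv (λ i → ν (suc i) ⊙ f (suc i)) g n)
      ⊕ (f 0 ⊙ (ν (suc n) ⊙ g (suc n)) ⊕ conv (f ∘ suc) (θ g) n)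
    ≡⟨ cong (λ z → (0ℂ ⊙ f 0 ⊙ g (suc n) ⊕ z)
         ⊕ (f 0 ⊙ (ν (suc n) ⊙ g (suc n)) ⊕ conv (f ∘ suc) (θ g) n)) split ⟩
  (0ℂ ⊙ f 0 ⊙ g (suc n) ⊕ (conv (f ∘ suc) g n ⊕ conv (θ (f ∘ suc)) g n))
      ⊕ (f 0 ⊙ (ν (suc n) ⊙ g (suc n)) ⊕ conv (f ∘ suc) (θ g) n)
    ≡⟨ solve 6 (λ x y k u v w → (con 0ℂ :* x :* y :+ (u :+ v)) :+ (x :* (k :* y) :+ w)
         := k :* (x :* y) :+ u :+ (v :+ w)) refl (f 0) (g (suc n)) (ν (suc n))
         (conv (f ∘ suc) g n)
         (conv (θ (f ∘ suc)) g n) (conv (f ∘ suc) (θ g) n) ⟩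
  ν (suc n) ⊙ (f 0 ⊙ g (suc n)) ⊕ conv (f ∘ suc) g n
      ⊕ (conv (θ (f ∘ suc)) g n ⊕ conv (f ∘ suc) (θ g) n)
    ≡⟨ cong (ν (suc n) ⊙ (f 0 ⊙ g (suc n)) ⊕ conv (f ∘ suc) g n ⊕_) (conv-θ (f ∘ suc) g n) ⟩
  (1ℂ ⊕ ν n) ⊙ (f 0 ⊙ g (suc n)) ⊕ conv (f ∘ suc) g n ⊕ ν n ⊙ conv (f ∘ suc) g n
    ≡⟨ solve 3 (λ k x u → (con 1ℂ :+ k) :* x :+ u :+ k :* u := (con 1ℂ :+ k) :* (x :+ u)) refl
         (ν n) (f 0 ⊙ g (suc n)) (conv (f ∘ suc) g n) ⟩
  ν (suc n) ⊙ (f 0 ⊙ g (suc n) ⊕ conv (f ∘ suc) g n) ∎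
  where
  open ≡-Reasoning
  open ℚ[i]-Solver
  split : conv (λ i → ν (suc i) ⊙ f (suc i)) g n ≡ conv (f ∘ suc) g n ⊕ conv (θ (f ∘ suc)) g n
  split = begin
    conv (λ i → ν (suc i) ⊙ f (suc i)) g n
      ≡⟨ conv-comm (λ i → ν (suc i) ⊙ f (suc i)) g n ⟩
    conv g (λ i → (1ℂ ⊕ ν i) ⊙ f (suc i)) n
      ≡⟨ conv-cong n (λ _ _ → refl) (λ i _ →
           solve 2 (λ k x → (con 1ℂ :+ k) :* x := x :+ k :* x) refl (ν i) (f (suc i))) ⟩
    conv g (λ i → f (suc i) ⊕ θ (f ∘ suc) i) n
      ≡⟨ conv-⊕ g (f ∘ suc) (θ (f ∘ suc)) n ⟩
    conv g (f ∘ suc) n ⊕ conv g (θ (f ∘ suc)) n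
      ≡⟨ cong₂ _⊕_ (conv-comm g (f ∘ suc) n) (conv-comm g (θ (f ∘ suc)) n) ⟩
    conv (f ∘ suc) g n ⊕ conv (θ (f ∘ suc)) g n ∎

conv-zeroʳ : ∀ f {g} n → (∀ i → i ≤ n → g i ≡ 0ℂ) → conv f g n ≡ 0ℂ
conv-zeroʳ f {g} zero    g≡0 rewrite g≡0 0 z≤n = solve 1 (λ x → x :* con 0ℂ := con 0ℂ) refl (f 0)
  where open ℚ[i]-Solver
conv-zeroʳ f {g} (suc n) g≡0
  rewrite g≡0 (suc n) ℕ.≤-refl | conv-zeroʳ (f ∘ suc) n (λ i i≤n → g≡0 i (ℕ.m≤n⇒m≤1+n i≤n)) =
  solve 1 (λ x → x :* con 0ℂ :+ con 0ℂ := con 0ℂ) refl (f 0)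
  where open ℚ[i]-Solver

-- Strong induction: once `g` vanishes up to n, the coefficient n + 1 of the product reduces to
-- `f 0 ⊙ g (suc n)`, which is `g (suc n)`.
conv-cancelˡ : ∀ {f g} → f 0 ≡ 1ℂ → (∀ n → conv f g n ≡ 0ℂ) → ∀ n → g n ≡ 0ℂ
conv-cancelˡ {f} {g} f₀≡1 fg≡0 n = below n n ℕ.≤-refl
  where
  open ≡-Reasoning
  below : ∀ n i → i ≤ n → g i ≡ 0ℂ
  head  : ∀ n → conv (f ∘ suc) g n ≡ 0ℂ → g (suc n) ≡ 0ℂ
  below zero zero z≤n = begin
    g 0        ≡⟨ ⊙-identityˡ (g 0) ⟨
    1ℂ ⊙ g 0   ≡⟨ cong (_⊙ g 0) f₀≡1 ⟨
    f 0 ⊙ g 0  ≡⟨ fg≡0 0 ⟩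
    0ℂ         ∎
  below (suc n) i i≤1+n with ℕ.m≤n⇒m<n∨m≡n i≤1+n
  ... | inj₁ (s≤s i≤n) = below n i i≤n
  ... | inj₂ refl      = head n (conv-zeroʳ (f ∘ suc) n (below n))
  head n tail≡0 = begin
    g (suc n)                                      ≡⟨ solve 1 (λ x → x := con 1ℂ :* x :+ con 0ℂ) refl (g (suc n)) ⟩
    1ℂ ⊙ g (suc n) ⊕ 0ℂ                            ≡⟨ cong₂ (λ x y → x ⊙ g (suc n) ⊕ y) f₀≡1 tail≡0 ⟨
    conv f g (suc n)                               ≡⟨ fg≡0 (suc n) ⟩
    0ℂ                                             ∎
    where open ℚ[i]-Solver

-- Recurrences from square roots of quadratic polynomials

z⊕z≡0⇒z≡0 : ∀ z → z ⊕ z ≡ 0ℂ → z ≡ 0ℂ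
z⊕z≡0⇒z≡0 z z⊕z≡0 = begin
  z                ≡⟨ solve 1 (λ z → z := con (ι ½) :* (z :+ z)) refl z ⟩
  ι ½ ⊙ (z ⊕ z)    ≡⟨ cong (ι ½ ⊙_) z⊕z≡0 ⟩
  ι ½ ⊙ 0ℂ         ∎
  where
  open ≡-Reasoning
  open ℚ[i]-Solver

-- If S² = Δ with Δ = 1 - 2bX + DX², then 2ΔS′ = Δ′S, because S(2ΔS′ - Δ′S) = 0.
module SquareRoot
  (s : ℕ → ℚ[i]) (b D : ℚ[i])
  (s₀≡1 : s 0 ≡ 1ℂ)
  (S²₀ : conv s s 0 ≡ 1ℂ) (S²₁ : conv s s 1 ≡ ⊖ (b ⊕ b)) (S²₂ : conv s s 2 ≡ D)
  (S²₊ : ∀ n → conv s s (3 ℕ.+ n) ≡ 0ℂ)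
  where

  private
    T : ℕ → ℚ[i]
    T = conv s (θ s)

    T⊕T : ∀ n → T n ⊕ T n ≡ ν n ⊙ conv s s n
    T⊕T n = trans (cong (_⊕ T n) (conv-comm s (θ s) n)) (conv-θ s s n)

    -- `defect` is ΔθS - ½(θΔ)S, with `p` and `q` collecting the terms at X and X². The products of
    -- these two with S are `P` and `Q`.
    p q defect : ℕ → ℚ[i]
    p n = b ⊙ s n ⊕ ⊖ (b ⊕ b) ⊙ θ s n
    q n = D ⊙ θ s n ⊕ ⊖ D ⊙ s n
    defect n = θ s n ⊕ shift (λ k → p k ⊕ shift q k) n

    P Q : ℕ → ℚ[i]
    P n = b ⊙ conv s s n ⊕ ⊖ (b ⊕ b) ⊙ T n
    Q n = D ⊙ T n ⊕ ⊖ D ⊙ conv s s n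

    conv-linear : ∀ c f d g n →
      conv s (λ i → c ⊙ f i ⊕ d ⊙ g i) n ≡ c ⊙ conv s f n ⊕ d ⊙ conv s g n
    conv-linear c f d g n =
      trans (conv-⊕ s (λ i → c ⊙ f i) (λ i → d ⊙ g i) n) (cong₂ _⊕_ (conv-⊙ʳ c s f n) (conv-⊙ʳ d s g n))

    shift-cong : ∀ {f g} → (∀ n → f n ≡ g n) → ∀ n → shift f n ≡ shift g n
    shift-cong f≗g zero    = refl
    shift-cong f≗g (suc n) = f≗g n

    conv-defect : ∀ n → conv s defect n ≡ T n ⊕ shift (λ k → P k ⊕ shift Q k) n
    conv-defect n = begin
      conv s defect n
        ≡⟨ conv-⊕ s (θ s) (shift (λ k → p k ⊕ shift q k)) n ⟩
      T n ⊕ conv s (shift (λ k → p k ⊕ shift q k)) n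
        ≡⟨ cong (T n ⊕_) (conv-shift s (λ k → p k ⊕ shift q k) n) ⟩
      T n ⊕ shift (conv s (λ k → p k ⊕ shift q k)) n
        ≡⟨ cong (T n ⊕_) (shift-cong inner n) ⟩
      T n ⊕ shift (λ k → P k ⊕ shift Q k) n ∎
      where
      open ≡-Reasoning
      inner : ∀ k → conv s (λ k → p k ⊕ shift q k) k ≡ P k ⊕ shift Q k
      inner k = trans (conv-⊕ s p (shift q) k) (cong₂ _⊕_
        (conv-linear b s (⊖ (b ⊕ b)) (θ s) k)
        (trans (conv-shift s q k) (shift-cong (conv-linear D (θ s) (⊖ D) s) k)))

    -- Doubling turns each SθS into θ(S²) by the Leibniz rule, so that only coefficients of S²
    -- remain.
    2conv-defect : ∀ n → conv s defect (2 ℕ.+ n) ⊕ conv s defect (2 ℕ.+ n)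
      ≡ ν (2 ℕ.+ n) ⊙ conv s s (2 ℕ.+ n)
        ⊕ (b ⊕ b) ⊙ (conv s s (1 ℕ.+ n) ⊕ ⊖ (ν (1 ℕ.+ n) ⊙ conv s s (1 ℕ.+ n)))
        ⊕ D ⊙ (ν n ⊙ conv s s n ⊕ ⊖ (conv s s n ⊕ conv s s n))
    2conv-defect n = begin
      conv s defect (2 ℕ.+ n) ⊕ conv s defect (2 ℕ.+ n)
        ≡⟨ cong₂ _⊕_ (conv-defect (2 ℕ.+ n)) (conv-defect (2 ℕ.+ n)) ⟩
      (T (2 ℕ.+ n) ⊕ (P (1 ℕ.+ n) ⊕ Q n)) ⊕ (T (2 ℕ.+ n) ⊕ (P (1 ℕ.+ n) ⊕ Q n))
        ≡⟨ solve 7 (λ b D t₂ t₁ t₀ g₁ g₀ →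
             let e = t₂ :+ ((b :* g₁ :+ :- (b :+ b) :* t₁) :+ (D :* t₀ :+ :- D :* g₀)) in
             e :+ e := (t₂ :+ t₂) :+ (b :+ b) :* (g₁ :+ :- (t₁ :+ t₁)) :+ D :* ((t₀ :+ t₀) :+ :- (g₀ :+ g₀)))
             refl b D (T (2 ℕ.+ n)) (T (1 ℕ.+ n)) (T n) (conv s s (1 ℕ.+ n)) (conv s s n) ⟩
      (T (2 ℕ.+ n) ⊕ T (2 ℕ.+ n))
        ⊕ (b ⊕ b) ⊙ (conv s s (1 ℕ.+ n) ⊕ ⊖ (T (1 ℕ.+ n) ⊕ T (1 ℕ.+ n)))
        ⊕ D ⊙ ((T n ⊕ T n) ⊕ ⊖ (conv s s n ⊕ conv s s n))
        ≡⟨ cong₂ _⊕_ (cong₂ _⊕_ (T⊕T (2 ℕ.+ n)) (cong (λ t → (b ⊕ b) ⊙ (conv s s (1 ℕ.+ n) ⊕ ⊖ t)) (T⊕T (1 ℕ.+ n))))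
             (cong (λ t → D ⊙ (t ⊕ ⊖ (conv s s n ⊕ conv s s n))) (T⊕T n)) ⟩
      ν (2 ℕ.+ n) ⊙ conv s s (2 ℕ.+ n)
        ⊕ (b ⊕ b) ⊙ (conv s s (1 ℕ.+ n) ⊕ ⊖ (ν (1 ℕ.+ n) ⊙ conv s s (1 ℕ.+ n)))
        ⊕ D ⊙ (ν n ⊙ conv s s n ⊕ ⊖ (conv s s n ⊕ conv s s n)) ∎
      where
      open ≡-Reasoning
      open ℚ[i]-Solver

    -- The product is ½(ΔθΔ - (θΔ)Δ) = 0, verified coefficientwise. Since Δ has degree 2, all
    -- coefficients of S² involved vanish from index 5 on. Indices 2, 3 and 4 use the known values
    -- in the same formula; 0 and 1 are separate because `2conv-defect` starts at index 2.
    conv-defect≡0 : ∀ n → conv s defect n ≡ 0ℂ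
    conv-defect≡0 n = z⊕z≡0⇒z≡0 (conv s defect n) (twice n)
      where
      open ℚ[i]-Solver
      values : ∀ n {g₂ g₁ g₀} → conv s s (2 ℕ.+ n) ≡ g₂ → conv s s (1 ℕ.+ n) ≡ g₁ → conv s s n ≡ g₀ →
        conv s defect (2 ℕ.+ n) ⊕ conv s defect (2 ℕ.+ n)
          ≡ ν (2 ℕ.+ n) ⊙ g₂ ⊕ (b ⊕ b) ⊙ (g₁ ⊕ ⊖ (ν (1 ℕ.+ n) ⊙ g₁)) ⊕ D ⊙ (ν n ⊙ g₀ ⊕ ⊖ (g₀ ⊕ g₀))
      values n refl refl refl = 2conv-defect n
      twice : ∀ n → conv s defect n ⊕ conv s defect n ≡ 0ℂ
      twice 0 = trans (cong₂ _⊕_ (conv-defect 0) (conv-defect 0))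
        (trans (solve 1 (λ t → (t :+ con 0ℂ) :+ (t :+ con 0ℂ) := t :+ t) refl (T 0))
        (trans (T⊕T 0) (solve 1 (λ g → con 0ℂ :* g := con 0ℂ) refl (conv s s 0))))
      twice 1 = trans (cong₂ _⊕_ (conv-defect 1) (conv-defect 1))
        (trans (solve 4 (λ b t₁ t₀ g₀ →
                 let e = t₁ :+ ((b :* g₀ :+ :- (b :+ b) :* t₀) :+ con 0ℂ) in
                 e :+ e := (t₁ :+ t₁) :+ (b :+ b) :* (g₀ :+ :- (t₀ :+ t₀))) refl b (T 1) (T 0) (conv s s 0))
        (trans (cong₂ (λ t₁ t₀ → t₁ ⊕ (b ⊕ b) ⊙ (conv s s 0 ⊕ ⊖ t₀)) (T⊕T 1) (T⊕T 0))
        (trans (cong₂ (λ g₁ g₀ → 1ℂ ⊙ g₁ ⊕ (b ⊕ b) ⊙ (g₀ ⊕ ⊖ (0ℂ ⊙ g₀))) S²₁ S²₀)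
        (solve 1 (λ b → con 1ℂ :* (:- (b :+ b)) :+ (b :+ b) :* (con 1ℂ :+ :- (con 0ℂ :* con 1ℂ)) := con 0ℂ)
          refl b))))
      twice 2 = trans (values 0 S²₂ S²₁ S²₀)
        (solve 2 (λ b D → con (ν 2) :* D :+ (b :+ b) :* (:- (b :+ b) :+ :- (con (ν 1) :* :- (b :+ b)))
          :+ D :* (con (ν 0) :* con 1ℂ :+ :- (con 1ℂ :+ con 1ℂ)) := con 0ℂ) refl b D)
      twice 3 = trans (values 1 (S²₊ 0) S²₂ S²₁)
        (solve 2 (λ b D → con (ν 3) :* con 0ℂ :+ (b :+ b) :* (D :+ :- (con (ν 2) :* D))
          :+ D :* (con (ν 1) :* :- (b :+ b) :+ :- (:- (b :+ b) :+ :- (b :+ b))) := con 0ℂ) refl b D)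
      twice 4 = trans (values 2 (S²₊ 1) (S²₊ 0) S²₂)
        (solve 2 (λ b D → con (ν 4) :* con 0ℂ :+ (b :+ b) :* (con 0ℂ :+ :- (con (ν 3) :* con 0ℂ))
          :+ D :* (con (ν 2) :* D :+ :- (D :+ D)) := con 0ℂ) refl b D)
      twice (suc (suc (suc (suc (suc n))))) = trans (values (3 ℕ.+ n) (S²₊ (2 ℕ.+ n)) (S²₊ (1 ℕ.+ n)) (S²₊ n))
        (solve 5 (λ b D x y z → x :* con 0ℂ :+ (b :+ b) :* (con 0ℂ :+ :- (y :* con 0ℂ))
          :+ D :* (z :* con 0ℂ :+ :- (con 0ℂ :+ con 0ℂ)) := con 0ℂ) refl
          b D (ν (5 ℕ.+ n)) (ν (4 ℕ.+ n)) (ν (3 ℕ.+ n)))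

  -- The coefficient of X^(n + 2) in the defect, which is zero because S has constant term 1 and can
  -- be cancelled.
  sqrt-recurrence : ∀ n →
    ν (2 ℕ.+ n) ⊙ s (2 ℕ.+ n)
      ⊕ ((b ⊙ s (1 ℕ.+ n) ⊕ ⊖ (b ⊕ b) ⊙ (ν (1 ℕ.+ n) ⊙ s (1 ℕ.+ n))) ⊕ (D ⊙ (ν n ⊙ s n) ⊕ ⊖ D ⊙ s n)) ≡ 0ℂ
  sqrt-recurrence n = conv-cancelˡ {g = defect} s₀≡1 conv-defect≡0 (2 ℕ.+ n)

-- The generating function F of a satisfies F = 1 + bXF + cX²F², so S = 1 - bX - 2cX²F is a
-- square root of 1 - 2bX + (b² - 4c)X².
module Motzkin
  (a : ℕ → ℚ[i]) (b c : ℚ[i])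
  (a₀ : a 0 ≡ 1ℂ) (a₁ : a 1 ≡ b)
  (a₊ : ∀ n → a (2 ℕ.+ n) ≡ b ⊙ a (1 ℕ.+ n) ⊕ c ⊙ conv a a n)
  where

  discriminant : ℚ[i]
  discriminant = b ⊙ b ⊕ ⊖ (c ⊕ c ⊕ (c ⊕ c))

  private
    D k : ℚ[i]
    D = discriminant
    k = ⊖ (c ⊕ c)

    s : ℕ → ℚ[i]
    s 0             = 1ℂ
    s 1             = ⊖ b
    s (suc (suc n)) = k ⊙ a n

    open ≡-Reasoning
    open ℚ[i]-Solver

    S²₀ : conv s s 0 ≡ 1ℂ
    S²₀ = refl

    S²₁ : conv s s 1 ≡ ⊖ (b ⊕ b)
    S²₁ = solve 1 (λ b → con 1ℂ :* :- b :+ :- b :* con 1ℂ := :- (b :+ b)) refl b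

    S²₂ : conv s s 2 ≡ D
    S²₂ = trans (cong (λ x → 1ℂ ⊙ (k ⊙ x) ⊕ (⊖ b ⊙ ⊖ b ⊕ k ⊙ x ⊙ 1ℂ)) a₀)
      (solve 2 (λ b c → let k = :- (c :+ c) in
        con 1ℂ :* (k :* con 1ℂ) :+ (:- b :* :- b :+ k :* con 1ℂ :* con 1ℂ)
          := b :* b :+ :- (c :+ c :+ (c :+ c))) refl b c)

    -- Apart from the two outer terms at each end, the convolution is k² times that of `a`. By `a₊`
    -- the outer terms contribute 2kc times the same convolution, and k² + 2kc = 0 for k = -2c.
    -- Index 3 has no inner part and needs only `a₀` and `a₁`.
    S²₊ : ∀ n → conv s s (3 ℕ.+ n) ≡ 0ℂ
    S²₊ zero = trans (cong₂ (λ x y → 1ℂ ⊙ (k ⊙ y) ⊕ (⊖ b ⊙ (k ⊙ x) ⊕ (k ⊙ x ⊙ ⊖ b ⊕ k ⊙ y ⊙ 1ℂ))) a₀ a₁)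
      (solve 2 (λ b c → let k = :- (c :+ c) in
        con 1ℂ :* (k :* b) :+ (:- b :* (k :* con 1ℂ) :+ (k :* con 1ℂ :* :- b :+ k :* b :* con 1ℂ))
          := con 0ℂ) refl b c)
    S²₊ (suc n) = begin
      1ℂ ⊙ (k ⊙ a (2 ℕ.+ n)) ⊕ (⊖ b ⊙ (k ⊙ a (1 ℕ.+ n)) ⊕ conv (λ i → k ⊙ a i) s (2 ℕ.+ n))
        ≡⟨ cong (λ z → 1ℂ ⊙ (k ⊙ a (2 ℕ.+ n)) ⊕ (⊖ b ⊙ (k ⊙ a (1 ℕ.+ n)) ⊕ z)) (begin
          conv (λ i → k ⊙ a i) s (2 ℕ.+ n)
            ≡⟨ conv-last (λ i → k ⊙ a i) s (1 ℕ.+ n) ⟩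
          conv (λ i → k ⊙ a i) (s ∘ suc) (1 ℕ.+ n) ⊕ k ⊙ a (2 ℕ.+ n) ⊙ 1ℂ
            ≡⟨ cong (_⊕ k ⊙ a (2 ℕ.+ n) ⊙ 1ℂ) (conv-last (λ i → k ⊙ a i) (s ∘ suc) n) ⟩
          conv (λ i → k ⊙ a i) (λ i → k ⊙ a i) n ⊕ k ⊙ a (1 ℕ.+ n) ⊙ ⊖ b ⊕ k ⊙ a (2 ℕ.+ n) ⊙ 1ℂ
            ≡⟨ cong (λ z → z ⊕ k ⊙ a (1 ℕ.+ n) ⊙ ⊖ b ⊕ k ⊙ a (2 ℕ.+ n) ⊙ 1ℂ) (conv-⊙ k k a a n) ⟩
          k ⊙ k ⊙ conv a a n ⊕ k ⊙ a (1 ℕ.+ n) ⊙ ⊖ b ⊕ k ⊙ a (2 ℕ.+ n) ⊙ 1ℂ ∎) ⟩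
      1ℂ ⊙ (k ⊙ a (2 ℕ.+ n)) ⊕ (⊖ b ⊙ (k ⊙ a (1 ℕ.+ n))
        ⊕ (k ⊙ k ⊙ conv a a n ⊕ k ⊙ a (1 ℕ.+ n) ⊙ ⊖ b ⊕ k ⊙ a (2 ℕ.+ n) ⊙ 1ℂ))
        ≡⟨ cong (λ x → 1ℂ ⊙ (k ⊙ x) ⊕ (⊖ b ⊙ (k ⊙ a (1 ℕ.+ n))
             ⊕ (k ⊙ k ⊙ conv a a n ⊕ k ⊙ a (1 ℕ.+ n) ⊙ ⊖ b ⊕ k ⊙ x ⊙ 1ℂ))) (a₊ n) ⟩
      1ℂ ⊙ (k ⊙ (b ⊙ a (1 ℕ.+ n) ⊕ c ⊙ conv a a n)) ⊕ (⊖ b ⊙ (k ⊙ a (1 ℕ.+ n))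
        ⊕ (k ⊙ k ⊙ conv a a n ⊕ k ⊙ a (1 ℕ.+ n) ⊙ ⊖ b ⊕ k ⊙ (b ⊙ a (1 ℕ.+ n) ⊕ c ⊙ conv a a n) ⊙ 1ℂ))
        ≡⟨ solve 4 (λ b c x y → let k = :- (c :+ c) ; z = k :* (b :* x :+ c :* y) in
             con 1ℂ :* z :+ (:- b :* (k :* x) :+ (k :* k :* y :+ k :* x :* :- b :+ z :* con 1ℂ)) := con 0ℂ)
             refl b c (a (1 ℕ.+ n)) (conv a a n) ⟩
      0ℂ ∎

  -- From index 2 on the coefficients of S are -2c times those of F, so `sqrt-recurrence` at n + 2
  -- is -2c times the claim; multiplying by `⊖ v` leaves twice the difference of its sides. The
  -- factor 2(n + 3) - 1 appears as `ν (3 ℕ.+ n) ⊕ ν (2 ℕ.+ n)`.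
  three-term : ∀ {v} → v ⊙ c ≡ 1ℂ → ∀ n →
    ν (4 ℕ.+ n) ⊙ a (2 ℕ.+ n)
      ≡ (ν (3 ℕ.+ n) ⊕ ν (2 ℕ.+ n)) ⊙ (b ⊙ a (1 ℕ.+ n)) ⊕ ⊖ (ν (1 ℕ.+ n) ⊙ (D ⊙ a n))
  three-term {v} vc≡1 n = begin
    l             ≡⟨ solve 2 (λ l r → l := r :+ (l :+ :- r)) refl l r ⟩
    r ⊕ (l ⊕ ⊖ r) ≡⟨ cong (r ⊕_) (z⊕z≡0⇒z≡0 (l ⊕ ⊖ r) doubled) ⟩
    r ⊕ 0ℂ        ≡⟨ solve 1 (λ r → r :+ con 0ℂ := r) refl r ⟩
    r             ∎
    where
    l r : ℚ[i]
    l = ν (4 ℕ.+ n) ⊙ a (2 ℕ.+ n)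
    r = (ν (3 ℕ.+ n) ⊕ ν (2 ℕ.+ n)) ⊙ (b ⊙ a (1 ℕ.+ n)) ⊕ ⊖ (ν (1 ℕ.+ n) ⊙ (D ⊙ a n))
    open SquareRoot s b D refl S²₀ S²₁ S²₂ S²₊
    doubled : (l ⊕ ⊖ r) ⊕ (l ⊕ ⊖ r) ≡ 0ℂ
    doubled = begin
      (l ⊕ ⊖ r) ⊕ (l ⊕ ⊖ r)
        ≡⟨ solve 1 (λ x → x :+ x := con 1ℂ :* (x :+ x)) refl (l ⊕ ⊖ r) ⟩
      1ℂ ⊙ ((l ⊕ ⊖ r) ⊕ (l ⊕ ⊖ r))
        ≡⟨ cong (_⊙ ((l ⊕ ⊖ r) ⊕ (l ⊕ ⊖ r))) vc≡1 ⟨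
      v ⊙ c ⊙ ((l ⊕ ⊖ r) ⊕ (l ⊕ ⊖ r))
        ≡⟨ solve 8 (λ v c b D ν₁ x₀ x₁ x₂ →
             let k  = :- (c :+ c)
                 ν₂ = con 1ℂ :+ ν₁
                 ν₃ = con 1ℂ :+ ν₂
                 ν₄ = con 1ℂ :+ ν₃
                 y  = ν₄ :* x₂ :+ :- ((ν₃ :+ ν₂) :* (b :* x₁) :+ :- (ν₁ :* (D :* x₀)))
             in v :* c :* (y :+ y) := :- v :* (ν₄ :* (k :* x₂)
               :+ ((b :* (k :* x₁) :+ :- (b :+ b) :* (ν₃ :* (k :* x₁))) :+ (D :* (ν₂ :* (k :* x₀)) :+ :- D :* (k :* x₀)))))
             refl v c b D (ν (1 ℕ.+ n)) (a n) (a (1 ℕ.+ n)) (a (2 ℕ.+ n)) ⟩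
      ⊖ v ⊙ (ν (4 ℕ.+ n) ⊙ s (4 ℕ.+ n)
        ⊕ ((b ⊙ s (3 ℕ.+ n) ⊕ ⊖ (b ⊕ b) ⊙ (ν (3 ℕ.+ n) ⊙ s (3 ℕ.+ n)))
          ⊕ (D ⊙ (ν (2 ℕ.+ n) ⊙ s (2 ℕ.+ n)) ⊕ ⊖ D ⊙ s (2 ℕ.+ n))))
        ≡⟨ cong (⊖ v ⊙_) (sqrt-recurrence (2 ℕ.+ n)) ⟩
      ⊖ v ⊙ 0ℂ
        ≡⟨ solve 1 (λ v → :- v :* con 0ℂ := con 0ℂ) refl v ⟩
      0ℂ ∎

-- Right-edge weights of the enumerated trees

module TreeWeights (w : ℚ[i]) where

  open ≡-Reasoning
  open ℚ[i]-Solver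

  weight : List Tree → ℚ[i]
  weight []       = 0ℂ
  weight (t ∷ ts) = w ^ rightEdges t ⊕ weight ts

  weight-++ : ∀ ts us → weight (ts ++ us) ≡ weight ts ⊕ weight us
  weight-++ []       us = solve 1 (λ x → x := con 0ℂ :+ x) refl (weight us)
  weight-++ (t ∷ ts) us = trans (cong (w ^ rightEdges t ⊕_) (weight-++ ts us))
    (solve 3 (λ x y z → x :+ (y :+ z) := x :+ y :+ z) refl (w ^ rightEdges t) (weight ts) (weight us))

  weight-left : ∀ ts → weight (map left ts) ≡ weight ts
  weight-left []       = refl
  weight-left (t ∷ ts) = cong (w ^ rightEdges t ⊕_) (weight-left ts)

  weight-right : ∀ ts → weight (map right ts) ≡ w ⊙ weight ts
  weight-right []       = solve 1 (λ w → con 0ℂ := w :* con 0ℂ) refl w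
  weight-right (t ∷ ts) = trans (cong (w ⊙ w ^ rightEdges t ⊕_) (weight-right ts))
    (sym (⊙-distribˡ-⊕ w (w ^ rightEdges t) (weight ts)))

  private
    join : Fin 2 → Tree × Tree → Tree
    join a (l , r) = both a l r

  weight-join-row : ∀ a l rs → weight (map (join a) (map (l ,_) rs)) ≡ w ⊙ (w ^ rightEdges l ⊙ weight rs)
  weight-join-row a l []       = solve 2 (λ w x → con 0ℂ := w :* (x :* con 0ℂ)) refl w (w ^ rightEdges l)
  weight-join-row a l (r ∷ rs) = trans
    (cong₂ _⊕_ (cong (w ⊙_) (^-homo-* w (rightEdges l) (rightEdges r))) (weight-join-row a l rs))
    (solve 4 (λ w x y z → w :* (x :* y) :+ w :* (x :* z) := w :* (x :* (y :+ z))) refl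
      w (w ^ rightEdges l) (w ^ rightEdges r) (weight rs))

  weight-join : ∀ a ls rs → weight (map (join a) (cartesianProduct ls rs)) ≡ w ⊙ (weight ls ⊙ weight rs)
  weight-join a []       rs = solve 2 (λ w x → con 0ℂ := w :* (con 0ℂ :* x)) refl w (weight rs)
  weight-join a (l ∷ ls) rs = begin
    weight (map (join a) (map (l ,_) rs ++ cartesianProduct ls rs))
      ≡⟨ cong weight (map-++ (join a) (map (l ,_) rs) (cartesianProduct ls rs)) ⟩
    weight (map (join a) (map (l ,_) rs) ++ map (join a) (cartesianProduct ls rs))
      ≡⟨ weight-++ (map (join a) (map (l ,_) rs)) (map (join a) (cartesianProduct ls rs)) ⟩
    weight (map (join a) (map (l ,_) rs)) ⊕ weight (map (join a) (cartesianProduct ls rs))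
      ≡⟨ cong₂ _⊕_ (weight-join-row a l rs) (weight-join a ls rs) ⟩
    w ⊙ (w ^ rightEdges l ⊙ weight rs) ⊕ w ⊙ (weight ls ⊙ weight rs)
      ≡⟨ solve 4 (λ w x y z → w :* (x :* z) :+ w :* (y :* z) := w :* ((x :+ y) :* z)) refl
           w (w ^ rightEdges l) (weight ls) (weight rs) ⟩
    w ⊙ ((w ^ rightEdges l ⊕ weight ls) ⊙ weight rs) ∎

  -- One factor w for the right edge at the root, one summand for each of the two labels.
  weight-both : ∀ ls rs → weight (bothFrom ls rs) ≡ (w ⊕ w) ⊙ (weight ls ⊙ weight rs)
  weight-both ls rs = begin
    weight (map (join zero) lrs ++ map (join (suc zero)) lrs ++ [])
      ≡⟨ weight-++ (map (join zero) lrs) (map (join (suc zero)) lrs ++ []) ⟩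
    weight (map (join zero) lrs) ⊕ weight (map (join (suc zero)) lrs ++ [])
      ≡⟨ cong₂ _⊕_ (weight-join zero ls rs)
           (trans (weight-++ (map (join (suc zero)) lrs) [])
             (cong (_⊕ 0ℂ) (weight-join (suc zero) ls rs))) ⟩
    w ⊙ (weight ls ⊙ weight rs) ⊕ (w ⊙ (weight ls ⊙ weight rs) ⊕ 0ℂ)
      ≡⟨ solve 2 (λ w x → w :* x :+ (w :* x :+ con 0ℂ) := (w :+ w) :* x) refl w (weight ls ⊙ weight rs) ⟩
    (w ⊕ w) ⊙ (weight ls ⊙ weight rs) ∎
    where
    lrs : List (Tree × Tree)
    lrs = cartesianProduct ls rs

  -- Stated for an arbitrary index sequence `h` and two sequences `u` and `v`, since the induction
  -- advances `h` and `u` but leaves `v` in place.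
  weight-concatMap : ∀ (g : ℕ → List Tree) (h : ℕ → ℕ) {u v : ℕ → ℚ[i]} {d} m →
    (∀ i → weight (g (h i)) ≡ d ⊙ (u i ⊙ v (m ∸ i))) →
    weight (concatMap g (applyUpTo h (suc m))) ≡ d ⊙ conv u v m
  weight-concatMap g h {u} {v} {d} zero    eq = begin
    weight (g (h 0) ++ [])     ≡⟨ weight-++ (g (h 0)) [] ⟩
    weight (g (h 0)) ⊕ 0ℂ      ≡⟨ cong (_⊕ 0ℂ) (eq 0) ⟩
    d ⊙ (u 0 ⊙ v 0) ⊕ 0ℂ       ≡⟨ solve 1 (λ x → x :+ con 0ℂ := x) refl (d ⊙ (u 0 ⊙ v 0)) ⟩
    d ⊙ (u 0 ⊙ v 0)            ∎
  weight-concatMap g h {u} {v} {d} (suc m) eq = begin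
    weight (g (h 0) ++ concatMap g (applyUpTo (h ∘ suc) (suc m)))
      ≡⟨ weight-++ (g (h 0)) (concatMap g (applyUpTo (h ∘ suc) (suc m))) ⟩
    weight (g (h 0)) ⊕ weight (concatMap g (applyUpTo (h ∘ suc) (suc m)))
      ≡⟨ cong₂ _⊕_ (eq 0) (weight-concatMap g (h ∘ suc) {u ∘ suc} {v} {d} m (eq ∘ suc)) ⟩
    d ⊙ (u 0 ⊙ v (suc m)) ⊕ d ⊙ conv (u ∘ suc) v m
      ≡⟨ ⊙-distribˡ-⊕ d (u 0 ⊙ v (suc m)) (conv (u ∘ suc) v m) ⟨
    d ⊙ conv u v (suc m) ∎

  enumWeight : (f n : ℕ) → ℚ[i]
  enumWeight f n = weight (enum f n)

  enumWeight-suc : ∀ f m → enumWeight (suc f) (suc m)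
    ≡ weight (leaves m) ⊕ (enumWeight f m ⊕ (w ⊙ enumWeight f m ⊕ (w ⊕ w) ⊙ conv (enumWeight f) (enumWeight f) m))
  enumWeight-suc f m =
    trans (weight-++ (leaves m) _) (cong (weight (leaves m) ⊕_)
      (trans (weight-++ (map left (enum f m)) _) (cong₂ _⊕_ (weight-left (enum f m))
        (trans (weight-++ (map right (enum f m)) _) (cong₂ _⊕_ (weight-right (enum f m))
          (weight-concatMap (λ i → bothFrom (enum f i) (enum f (m ∸ i))) (λ i → i)
            {enumWeight f} {enumWeight f} {w ⊕ w} m
            (λ i → weight-both (enum f i) (enum f (m ∸ i)))))))))

  -- By `enumWeight-suc` the value at m + 1 depends only on values at indices up to m, for which the
  -- bounds still suffice; so the bound on levels is immaterial once it reaches the number of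
  -- vertices.
  enumWeight-fuel : ∀ f f′ n → n ≤ f → n ≤ f′ → enumWeight f n ≡ enumWeight f′ n
  enumWeight-fuel zero    zero     zero    _ _ = refl
  enumWeight-fuel zero    (suc f′) zero    _ _ = refl
  enumWeight-fuel (suc f) zero     zero    _ _ = refl
  enumWeight-fuel (suc f) (suc f′) zero    _ _ = refl
  enumWeight-fuel (suc f) (suc f′) (suc m) (s≤s m≤f) (s≤s m≤f′) = begin
    enumWeight (suc f) (suc m)
      ≡⟨ enumWeight-suc f m ⟩
    step (enumWeight f m) (conv (enumWeight f) (enumWeight f) m)
      ≡⟨ cong₂ step (same m ℕ.≤-refl) (conv-cong m same same) ⟩
    step (enumWeight f′ m) (conv (enumWeight f′) (enumWeight f′) m)
      ≡⟨ enumWeight-suc f′ m ⟨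
    enumWeight (suc f′) (suc m) ∎
    where
    step : ℚ[i] → ℚ[i] → ℚ[i]
    step x y = weight (leaves m) ⊕ (x ⊕ (w ⊙ x ⊕ (w ⊕ w) ⊙ y))
    same : ∀ i → i ≤ m → enumWeight f i ≡ enumWeight f′ i
    same i i≤m = enumWeight-fuel f f′ i (ℕ.≤-trans i≤m m≤f) (ℕ.≤-trans i≤m m≤f′)

  -- Indexed by the number of edges.
  treeWeight : ℕ → ℚ[i]
  treeWeight m = weight (trees (suc m))

  private
    p : ℕ → ℚ[i]
    p n = enumWeight n n

    p-suc : ∀ m → p (suc m) ≡ weight (leaves m) ⊕ (p m ⊕ (w ⊙ p m ⊕ (w ⊕ w) ⊙ conv p p m))
    p-suc m = trans (enumWeight-suc m m)
      (cong (λ y → weight (leaves m) ⊕ (p m ⊕ (w ⊙ p m ⊕ (w ⊕ w) ⊙ y))) (conv-cong m same same))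
      where
      same : ∀ i → i ≤ m → enumWeight m i ≡ p i
      same i i≤m = enumWeight-fuel m i i i≤m ℕ.≤-refl

  treeWeight-0 : treeWeight 0 ≡ 1ℂ
  treeWeight-0 = trans (p-suc 0)
    (solve 1 (λ w → (con 1ℂ :+ con 0ℂ) :+ (con 0ℂ :+ (w :* con 0ℂ :+ (w :+ w) :* (con 0ℂ :* con 0ℂ)))
      := con 1ℂ) refl w)

  treeWeight-1 : treeWeight 1 ≡ 1ℂ ⊕ w
  treeWeight-1 = trans (p-suc 1)
    (trans (cong (λ x → 0ℂ ⊕ (x ⊕ (w ⊙ x ⊕ (w ⊕ w) ⊙ (0ℂ ⊙ x ⊕ x ⊙ 0ℂ)))) treeWeight-0)
      (solve 1 (λ w → con 0ℂ :+ (con 1ℂ :+ (w :* con 1ℂ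
        :+ (w :+ w) :* (con 0ℂ :* con 1ℂ :+ con 1ℂ :* con 0ℂ))) := con 1ℂ :+ w) refl w))

  -- No tree has zero vertices, so `p 0` is zero and both end terms of `conv p p` drop out, which
  -- lowers the index of the convolution by two.
  treeWeight-suc : ∀ n → treeWeight (2 ℕ.+ n)
    ≡ (1ℂ ⊕ w) ⊙ treeWeight (1 ℕ.+ n) ⊕ (w ⊕ w) ⊙ conv treeWeight treeWeight n
  treeWeight-suc n = trans (p-suc (2 ℕ.+ n))
    (trans (cong (λ y → 0ℂ ⊕ (a ⊕ (w ⊙ a ⊕ (w ⊕ w) ⊙ (0ℂ ⊙ a ⊕ y)))) (conv-last (p ∘ suc) p n))
      (solve 3 (λ w a y → con 0ℂ :+ (a :+ (w :* a :+ (w :+ w) :* (con 0ℂ :* a :+ (y :+ a :* con 0ℂ))))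
        := (con 1ℂ :+ w) :* a :+ (w :+ w) :* y) refl w a (conv treeWeight treeWeight n)))
    where
    a : ℚ[i]
    a = treeWeight (1 ℕ.+ n)

-- Approximations of the values of the polynomial

-- `ℚ./ 1` normalises by a gcd, which is stuck on a variable, so the identity is checked on
-- unnormalised rationals.
+suc/1 : ∀ k → + suc k ℚ./ 1 ≡ 1ℚ + + k ℚ./ 1
+suc/1 k = ℚ.toℚᵘ-injective (begin
  ℚ.toℚᵘ (+ suc k ℚ./ 1)                 ≈⟨ ℚ.toℚᵘ-fromℚᵘ (mkℚᵘ (+ suc k) 0) ⟩
  mkℚᵘ (+ suc k) 0                       ≈⟨ *≡* (cong (λ i → (+ 1 ℤ.+ i) ℤ.* + 1) (sym (ℤ.*-identityʳ (+ k)))) ⟩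
  ℚᵘ.1ℚᵘ ℚᵘ.+ mkℚᵘ (+ k) 0               ≈⟨ ℚᵘ.+-congʳ ℚᵘ.1ℚᵘ (ℚ.toℚᵘ-fromℚᵘ (mkℚᵘ (+ k) 0)) ⟨
  ℚ.toℚᵘ 1ℚ ℚᵘ.+ ℚ.toℚᵘ (+ k ℚ./ 1)      ≈⟨ ℚ.toℚᵘ-homo-+ 1ℚ (+ k ℚ./ 1) ⟨
  ℚ.toℚᵘ (1ℚ + + k ℚ./ 1)                ∎)
  where
  open ℚᵘ.≃-Reasoning

-- Guarantees that the n coefficients of `BoNaPoly n` after the constant one count every tree with n
-- vertices.
rightEdges<vertices : ∀ t → rightEdges t ℕ.< vertices t
rightEdges<vertices leaf         = s≤s z≤n
rightEdges<vertices (left t)     = ℕ.m<n⇒m<1+n (rightEdges<vertices t)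
rightEdges<vertices (right t)    = s≤s (rightEdges<vertices t)
rightEdges<vertices (both _ l r) = s≤s (ℕ.+-mono-<-≤ (rightEdges<vertices l) (ℕ.<⇒≤ (rightEdges<vertices r)))

-- The specification of `boNaTrees` is instantiated at the value of k belonging to `t`, so that the
-- filter keeps `t`.
∈-trees⇒vertices : ∀ n {t} → t ∈ trees n → vertices t ≡ n
∈-trees⇒vertices n {t} t∈ = proj₁ (Equivalence.to (∈-boNaTrees n (suc (rightEdges t)) t)
  (∈-filter⁺ (λ u → suc (rightEdges u) ℕ.≟ suc (rightEdges t)) t∈ refl))

module Horner (w : ℚ[i]) where

  open TreeWeights w
  open ≡-Reasoning
  open ℚ[i]-Solver

  horner : (ℕ → ℚ[i]) → ℕ → ℚ[i]
  horner f zero    = 0ℂ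
  horner f (suc n) = f 0 ⊕ w ⊙ horner (f ∘ suc) n

  horner-cong : ∀ {f g} n → (∀ i → f i ≡ g i) → horner f n ≡ horner g n
  horner-cong zero    f≗g = refl
  horner-cong (suc n) f≗g = cong₂ (λ x y → x ⊕ w ⊙ y) (f≗g 0) (horner-cong n (f≗g ∘ suc))

  horner-0 : ∀ n → horner (λ _ → 0ℂ) n ≡ 0ℂ
  horner-0 zero    = refl
  horner-0 (suc n) = trans (cong (λ x → 0ℂ ⊕ w ⊙ x) (horner-0 n))
    (solve 1 (λ w → con 0ℂ :+ w :* con 0ℂ := con 0ℂ) refl w)

  horner-⊕ : ∀ f g n → horner (λ i → f i ⊕ g i) n ≡ horner f n ⊕ horner g n
  horner-⊕ f g zero    = refl
  horner-⊕ f g (suc n) = trans (cong (λ x → f 0 ⊕ g 0 ⊕ w ⊙ x) (horner-⊕ (f ∘ suc) (g ∘ suc) n))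
    (solve 5 (λ w x y u v → x :+ y :+ w :* (u :+ v) := (x :+ w :* u) :+ (y :+ w :* v)) refl
      w (f 0) (g 0) (horner (f ∘ suc) n) (horner (g ∘ suc) n))

  -- Tested by `≡ᵇ` because the `ℕ.≟` inside the filter of `count` computes by it, so that a single
  -- `with` in `count-∷` decides both.
  δ : ℕ → ℕ → ℚ[i]
  δ r i = if r ℕ.≡ᵇ i then 1ℂ else 0ℂ

  horner-δ : ∀ r n → r ℕ.< n → horner (δ r) n ≡ w ^ r
  horner-δ zero    (suc n) _         = trans (cong (λ x → 1ℂ ⊕ w ⊙ x) (horner-0 n))
    (solve 1 (λ w → con 1ℂ :+ w :* con 0ℂ := con 1ℂ) refl w)
  horner-δ (suc r) (suc n) (s≤s r<n) = trans (cong (λ x → 0ℂ ⊕ w ⊙ x) (horner-δ r n r<n))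
    (solve 2 (λ w x → con 0ℂ :+ w :* x := w :* x) refl w (w ^ r))

  count : List Tree → ℕ → ℚ[i]
  count ts i = ι (+ length (filter (λ t → suc (rightEdges t) ℕ.≟ suc i) ts) ℚ./ 1)

  count-∷ : ∀ t ts i → count (t ∷ ts) i ≡ δ (rightEdges t) i ⊕ count ts i
  count-∷ t ts i with rightEdges t ℕ.≡ᵇ i
  ... | true  = cong ι (+suc/1 (length (filter (λ t → suc (rightEdges t) ℕ.≟ suc i) ts)))
  ... | false = solve 1 (λ x → x := con 0ℂ :+ x) refl (count ts i)

  -- Each tree adds one unit coefficient, whose evaluation at `w` is its monomial; the bound on
  -- right edges places it among the first n coefficients.
  horner-count : ∀ ts n → All (λ t → rightEdges t ℕ.< n) ts → horner (count ts) n ≡ weight ts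
  horner-count []       n []         = horner-0 n
  horner-count (t ∷ ts) n (r<n ∷ rs) = begin
    horner (count (t ∷ ts)) n                               ≡⟨ horner-cong n (count-∷ t ts) ⟩
    horner (λ i → δ (rightEdges t) i ⊕ count ts i) n        ≡⟨ horner-⊕ (δ (rightEdges t)) (count ts) n ⟩
    horner (δ (rightEdges t)) n ⊕ horner (count ts) n       ≡⟨ cong₂ _⊕_ (horner-δ (rightEdges t) n r<n) (horner-count ts n rs) ⟩
    w ^ rightEdges t ⊕ weight ts                            ∎

  horner-BoNa : ∀ n → horner (λ i → ι (+ BoNa n (suc i) ℚ./ 1)) n ≡ weight (trees n)
  horner-BoNa n = horner-count (trees n) n (All.tabulate (λ {t} t∈ →
    subst (rightEdges t ℕ.<_) (∈-trees⇒vertices n t∈) (rightEdges<vertices t)))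

at : ℂ → ℕ → ℚ[i]
at z k = seq (re z) k , seq (im z) k

-- The operations of ℝ act term by term on sequences, so the k-th approximation of a value is
-- Horner's scheme in ℚ[i] at the k-th approximation of `z`.
at-eval : ∀ (c : ℕ → ℕ) n z k →
  at (eval (applyUpTo (λ i → fromℕ (c i)) n) z) k ≡ Horner.horner (at z k) (λ i → ι (+ c i ℚ./ 1)) n
at-eval c zero    z k = refl
at-eval c (suc n) z k = cong (λ x → ι (+ c 0 ℚ./ 1) ⊕ at z k ⊙ x) (at-eval (c ∘ suc) n z k)

at-BoNaPoly : ∀ m z k →
  at (eval (BoNaPoly (suc m)) z) k ≡ at z k ⊙ TreeWeights.treeWeight (at z k) m
at-BoNaPoly m z k = begin
  at (eval (BoNaPoly (suc m)) z) k
    ≡⟨ cong (λ x → 0ℂ ⊕ w ⊙ x) (at-eval (λ i → BoNa (suc m) (suc i)) (suc m) z k) ⟩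
  0ℂ ⊕ w ⊙ Horner.horner w (λ i → ι (+ BoNa (suc m) (suc i) ℚ./ 1)) (suc m)
    ≡⟨ cong (λ x → 0ℂ ⊕ w ⊙ x) (Horner.horner-BoNa w (suc m)) ⟩
  0ℂ ⊕ w ⊙ TreeWeights.treeWeight w m
    ≡⟨ solve 1 (λ x → con 0ℂ :+ x := x) refl (w ⊙ TreeWeights.treeWeight w m) ⟩
  w ⊙ TreeWeights.treeWeight w m ∎
  where
  open ≡-Reasoning
  open ℚ[i]-Solver
  w : ℚ[i]
  w = at z k

-- The order of ℚ and the norm of ℚ[i]

0≤p+q : ∀ {p q} → 0ℚ ℚ.≤ p → 0ℚ ℚ.≤ q → 0ℚ ℚ.≤ p + q
0≤p+q = ℚ.+-mono-≤

0≤p*q : ∀ {p q} → 0ℚ ℚ.≤ p → 0ℚ ℚ.≤ q → 0ℚ ℚ.≤ p * q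
0≤p*q {p} {q} 0≤p 0≤q = ℚ.nonNegative⁻¹ (p * q)
  {{ℚ.nonNeg*nonNeg⇒nonNeg p {{ℚ.nonNegative 0≤p}} q {{ℚ.nonNegative 0≤q}}}}

0<p*q : ∀ {p q} → 0ℚ ℚ.< p → 0ℚ ℚ.< q → 0ℚ ℚ.< p * q
0<p*q {p} {q} 0<p 0<q = ℚ.positive⁻¹ (p * q) {{ℚ.pos*pos⇒pos p {{ℚ.positive 0<p}} q {{ℚ.positive 0<q}}}}

0≤p² : ∀ p → 0ℚ ℚ.≤ p * p
0≤p² p with ℚ.≤-total 0ℚ p
... | inj₁ 0≤p = 0≤p*q 0≤p 0≤p
... | inj₂ p≤0 = subst (0ℚ ℚ.≤_) (solve 1 (λ p → :- p :* :- p := p :* p) refl p)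
                   (0≤p*q (ℚ.neg-antimono-≤ p≤0) (ℚ.neg-antimono-≤ p≤0))
  where open ℚ-Solver

p≤p+q : ∀ {p q} → 0ℚ ℚ.≤ q → p ℚ.≤ p + q
p≤p+q {p} {q} 0≤q = subst (ℚ._≤ p + q) (ℚ.+-identityʳ p) (ℚ.+-monoʳ-≤ p 0≤q)

p≤q+p : ∀ {p q} → 0ℚ ℚ.≤ q → p ℚ.≤ q + p
p≤q+p {p} {q} 0≤q = subst (p ℚ.≤_) (ℚ.+-comm p q) (p≤p+q 0≤q)

*-mono-≤-nonNeg : ∀ {p q r s} → 0ℚ ℚ.≤ p → p ℚ.≤ q → 0ℚ ℚ.≤ r → r ℚ.≤ s → p * r ℚ.≤ q * s
*-mono-≤-nonNeg {p} {q} {r} {s} 0≤p p≤q 0≤r r≤s = begin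
  p * r  ≤⟨ ℚ.*-monoʳ-≤-nonNeg r {{ℚ.nonNegative 0≤r}} p≤q ⟩
  q * r  ≤⟨ ℚ.*-monoˡ-≤-nonNeg q {{ℚ.nonNegative (ℚ.≤-trans 0≤p p≤q)}} r≤s ⟩
  q * s  ∎
  where open ℚ.≤-Reasoning

0≤n·1 : ∀ n → 0ℚ ℚ.≤ n · 1ℚ
0≤n·1 zero    = ℚ.≤-refl
0≤n·1 (suc n) = 0≤p+q (ℚ.nonNegative⁻¹ 1ℚ) (0≤n·1 n)

0<1+n·1 : ∀ n → 0ℚ ℚ.< suc n · 1ℚ
0<1+n·1 n = ℚ.+-mono-<-≤ (ℚ.positive⁻¹ 1ℚ) (0≤n·1 n)

reciprocal : ∀ {p} → 0ℚ ℚ.< p → ∃ λ r → 0ℚ ℚ.< r × r * p ≡ 1ℚ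
reciprocal {p} 0<p = ℚ.1/ p , ℚ.positive⁻¹ (ℚ.1/ p) {{ℚ.1/pos⇒pos p}} , ℚ.*-inverseˡ p
  where
  instance
    p-pos : ℚ.Positive p
    p-pos = ℚ.positive 0<p
    p-nz : ℚ.NonZero p
    p-nz = ℚ.pos⇒nonZero p

0≤norm : ∀ z → 0ℚ ℚ.≤ norm z
0≤norm (a , b) = 0≤p+q (0≤p² a) (0≤p² b)

norm-⊙ : ∀ z w → norm (z ⊙ w) ≡ norm z * norm w
norm-⊙ (a , b) (c , d) = solve 4 (λ a b c d →
  (a :* c :- b :* d) :* (a :* c :- b :* d) :+ (a :* d :+ b :* c) :* (a :* d :+ b :* c)
    := (a :* a :+ b :* b) :* (c :* c :+ d :* d)) refl a b c d
  where open ℚ-Solver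

conj-⊙ˡ : ∀ z → conj z ⊙ z ≡ ι (norm z)
conj-⊙ˡ (a , b) = cong₂ _,_
  (solve 2 (λ a b → a :* a :- (:- b) :* b := a :* a :+ b :* b) refl a b)
  (solve 2 (λ a b → a :* b :+ (:- b) :* a := con 0ℚ) refl a b)
  where open ℚ-Solver

ι-* : ∀ p q → ι (p * q) ≡ ι p ⊙ ι q
ι-* p q = cong₂ _,_
  (solve 2 (λ p q → p :* q := p :* q :- con 0ℚ :* con 0ℚ) refl p q)
  (solve 2 (λ p q → con 0ℚ := p :* con 0ℚ :+ con 0ℚ :* q) refl p q)
  where open ℚ-Solver

⊙-inverse : ∀ z → 0ℚ ℚ.< norm z → ∃ λ v → v ⊙ z ≡ 1ℂ
⊙-inverse z 0<∣z∣ with r , _ , r∣z∣≡1 ← reciprocal 0<∣z∣ = ι r ⊙ conj z , (begin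
  ι r ⊙ conj z ⊙ z     ≡⟨ ⊙-assoc (ι r) (conj z) z ⟩
  ι r ⊙ (conj z ⊙ z)   ≡⟨ cong (ι r ⊙_) (conj-⊙ˡ z) ⟩
  ι r ⊙ ι (norm z)     ≡⟨ ι-* r (norm z) ⟨
  ι (r * norm z)       ≡⟨ cong ι r∣z∣≡1 ⟩
  1ℂ                   ∎)
  where open ≡-Reasoning

-- The cone and its distance from 0

-- The ratios a (m + 1) / a m are shown to have the form αb - βD(conj b) with α ≥ 1 and β ≥ 0,
-- that is, after division by b, to lie in the cone spanned by 1 and -D/b².
coneElement : (b D : ℚ[i]) (α β : ℚ) → ℚ[i]
coneElement b D α β = ι α ⊙ b ⊕ ⊖ (ι β ⊙ (D ⊙ conj b))

conj-coneElement : ∀ b D α β → conj (coneElement b D α β) ≡ ι α ⊙ conj b ⊕ ⊖ (ι β ⊙ (conj D ⊙ b))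
conj-coneElement (b₁ , b₂) (D₁ , D₂) α β = cong₂ _,_
  (solve 6 (λ b₁ b₂ D₁ D₂ α β →
    (α :* b₁ :- con 0ℚ :* b₂) :+ :- (β :* (D₁ :* b₁ :- D₂ :* :- b₂) :- con 0ℚ :* (D₁ :* :- b₂ :+ D₂ :* b₁))
    := (α :* b₁ :- con 0ℚ :* :- b₂) :+ :- (β :* (D₁ :* b₁ :- :- D₂ :* b₂) :- con 0ℚ :* (D₁ :* b₂ :+ :- D₂ :* b₁)))
    refl b₁ b₂ D₁ D₂ α β)
  (solve 6 (λ b₁ b₂ D₁ D₂ α β →
    :- ((α :* b₂ :+ con 0ℚ :* b₁) :+ :- (β :* (D₁ :* :- b₂ :+ D₂ :* b₁) :+ con 0ℚ :* (D₁ :* b₁ :- D₂ :* :- b₂)))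
    := (α :* :- b₂ :+ con 0ℚ :* b₁) :+ :- (β :* (D₁ :* b₂ :+ :- D₂ :* b₁) :+ con 0ℚ :* (D₁ :* b₁ :- :- D₂ :* b₂)))
    refl b₁ b₂ D₁ D₂ α β)
  where open ℚ-Solver

-- The law of cosines for αb and βD(conj b); the cross term is αβ times the real part of D(conj b)².
norm-coneElement : ∀ b D α β → norm (coneElement b D α β)
  ≡ norm b * (α * α) + norm b * (β * β) * norm D - (α * β + α * β) * proj₁ (D ⊙ conj b ⊙ conj b)
norm-coneElement (b₁ , b₂) (D₁ , D₂) α β = solve 6 (λ b₁ b₂ D₁ D₂ α β →
  let x = (α :* b₁ :- con 0ℚ :* b₂) :+ :- (β :* (D₁ :* b₁ :- D₂ :* :- b₂) :- con 0ℚ :* (D₁ :* :- b₂ :+ D₂ :* b₁))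
      y = (α :* b₂ :+ con 0ℚ :* b₁) :+ :- (β :* (D₁ :* :- b₂ :+ D₂ :* b₁) :+ con 0ℚ :* (D₁ :* b₁ :- D₂ :* :- b₂))
      g = b₁ :* b₁ :+ b₂ :* b₂
      d = D₁ :* D₁ :+ D₂ :* D₂
  in x :* x :+ y :* y := g :* (α :* α) :+ g :* (β :* β) :* d :- (α :* β :+ α :* β)
       :* ((D₁ :* b₁ :- D₂ :* :- b₂) :* b₁ :- (D₁ :* :- b₂ :+ D₂ :* b₁) :* :- b₂))
  refl b₁ b₂ D₁ D₂ α β
  where open ℚ-Solver

module Cone (x y : ℚ) where

  w b c D : ℚ[i]
  w = x , y
  b = 1ℂ ⊕ w
  c = w ⊕ w
  D = b ⊙ b ⊕ ⊖ (c ⊕ c ⊕ (c ⊕ c))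

  -- `R` and `I` are the real and imaginary parts of D(conj b)², a positive multiple of D/b² when b
  -- is nonzero. Its squared modulus is `g * g * d`; the summand `t * t` keeps `K` positive for
  -- nonzero y even if D vanishes, and serves the case R ≤ 0 of the bound below.
  t g d R I K : ℚ
  t = y * y
  g = norm b
  d = norm D
  R = proj₁ (D ⊙ conj b ⊙ conj b)
  I = proj₂ (D ⊙ conj b ⊙ conj b)
  K = g * g * d + t * t

  private
    0≤t : 0ℚ ℚ.≤ t
    0≤t = 0≤p² y

    0≤g : 0ℚ ℚ.≤ g
    0≤g = 0≤norm b

    0≤d : 0ℚ ℚ.≤ d
    0≤d = 0≤norm D

    t≤g : t ℚ.≤ g
    t≤g = subst (ℚ._≤ g) (solve 1 (λ y → (con 0ℚ :+ y) :* (con 0ℚ :+ y) := y :* y) refl y)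
      (p≤q+p (0≤p² (1ℚ + x)))
      where open ℚ-Solver

    g²d : g * g * d ≡ R * R + I * I
    g²d = begin
      g * g * d                              ≡⟨ solve 2 (λ g d → g :* g :* d := d :* g :* g) refl g d ⟩
      d * g * g                              ≡⟨ cong (λ z → d * z * z) conj-norm ⟩
      d * norm (conj b) * norm (conj b)      ≡⟨ cong (_* norm (conj b)) (norm-⊙ D (conj b)) ⟨
      norm (D ⊙ conj b) * norm (conj b)      ≡⟨ norm-⊙ (D ⊙ conj b) (conj b) ⟨
      norm (D ⊙ conj b ⊙ conj b)             ∎
      where
      open ≡-Reasoning
      open ℚ-Solver
      conj-norm : g ≡ norm (conj b)
      conj-norm = solve 2 (λ u v → u :* u :+ v :* v := u :* u :+ (:- v) :* (:- v)) refl (1ℚ + x) (0ℚ + y)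

    -- With m = x² + y² one has R = 2(1 - m)² - 8y² - g² and I = 8y(m - 1) up to sign.
    I² : I * I ≡ t * t + t * ((+ 32 ℚ./ 1) * R + (+ 255 ℚ./ 1) * t + (+ 32 ℚ./ 1) * (g * g))
    I² = solve 2 (λ x y →
      let b₁ = con 1ℚ :+ x
          b₂ = con 0ℚ :+ y
          D₁ = (b₁ :* b₁ :- b₂ :* b₂) :+ :- (x :+ x :+ (x :+ x) :+ (x :+ x :+ (x :+ x)))
          D₂ = (b₁ :* b₂ :+ b₂ :* b₁) :+ :- (y :+ y :+ (y :+ y) :+ (y :+ y :+ (y :+ y)))
          W₁ = D₁ :* b₁ :- D₂ :* :- b₂
          W₂ = D₁ :* :- b₂ :+ D₂ :* b₁
          R  = W₁ :* b₁ :- W₂ :* :- b₂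
          I  = W₁ :* :- b₂ :+ W₂ :* b₁
          t  = y :* y
          g  = b₁ :* b₁ :+ b₂ :* b₂
      in I :* I := t :* t :+ t :* (con (+ 32 ℚ./ 1) :* R :+ con (+ 255 ℚ./ 1) :* t :+ con (+ 32 ℚ./ 1) :* (g :* g)))
      refl x y
      where open ℚ-Solver

  -- If R ≤ 0, the vectors b and -D(conj b) spanning the cone form no obtuse angle, and the norm is
  -- at least that of αb. Otherwise |I| ≥ t, and the norm is bounded below through the distance from
  -- αb to the line spanned by D(conj b).
  norm-coneElement-bound : ∀ {α β} → 1ℚ ℚ.≤ α → 0ℚ ℚ.≤ β → t * (t * t) ℚ.≤ norm (coneElement b D α β) * K
  norm-coneElement-bound {α} {β} 1≤α 0≤β with ℚ.≤-total R 0ℚ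
  ... | inj₁ R≤0 = *-mono-≤-nonNeg 0≤t t≤N (0≤p² t) (p≤q+p (0≤p*q (0≤p*q 0≤g 0≤g) 0≤d))
    where
    open ℚ.≤-Reasoning
    open ℚ-Solver
    0≤α : 0ℚ ℚ.≤ α
    0≤α = ℚ.≤-trans (ℚ.nonNegative⁻¹ 1ℚ) 1≤α
    t≤N : t ℚ.≤ norm (coneElement b D α β)
    t≤N = begin
      t                   ≡⟨ solve 1 (λ t → t := t :* (con 1ℚ :* con 1ℚ)) refl t ⟩
      t * (1ℚ * 1ℚ)       ≤⟨ *-mono-≤-nonNeg 0≤t t≤g (ℚ.nonNegative⁻¹ 1ℚ)
                               (*-mono-≤-nonNeg (ℚ.nonNegative⁻¹ 1ℚ) 1≤α (ℚ.nonNegative⁻¹ 1ℚ) 1≤α) ⟩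
      g * (α * α)         ≤⟨ p≤p+q (0≤p+q (0≤p*q (0≤p*q 0≤g (0≤p² β)) 0≤d)
                               (0≤p*q (0≤p+q (0≤p*q 0≤α 0≤β) (0≤p*q 0≤α 0≤β)) (ℚ.neg-antimono-≤ R≤0))) ⟩
      g * (α * α) + (g * (β * β) * d + (α * β + α * β) * - R)
        ≡⟨ solve 4 (λ u v k R → u :+ (v :+ k :* :- R) := u :+ v :- k :* R) refl
             (g * (α * α)) (g * (β * β) * d) (α * β + α * β) R ⟩
      g * (α * α) + g * (β * β) * d - (α * β + α * β) * R
        ≡⟨ norm-coneElement b D α β ⟨
      norm (coneElement b D α β) ∎
  ... | inj₂ 0≤R = begin
    t * (t * t)
      ≡⟨ solve 1 (λ t → t :* (t :* t) := t :* (con 1ℚ :* con 1ℚ :* (t :* t))) refl t ⟩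
    t * (1ℚ * 1ℚ * (t * t))
      ≤⟨ *-mono-≤-nonNeg 0≤t t≤g (0≤p*q (ℚ.nonNegative⁻¹ 1ℚ) (0≤p² t))
           (*-mono-≤-nonNeg (ℚ.nonNegative⁻¹ 1ℚ)
             (*-mono-≤-nonNeg (ℚ.nonNegative⁻¹ 1ℚ) 1≤α (ℚ.nonNegative⁻¹ 1ℚ) 1≤α) (0≤p² t) t²≤I²) ⟩
    g * (α * α * (I * I))
      -- The added square comes from completing the square in β.
      ≤⟨ ℚ.*-monoˡ-≤-nonNeg g {{ℚ.nonNegative 0≤g}} (p≤q+p (0≤p² (g * d * β - α * R))) ⟩
    g * ((g * d * β - α * R) * (g * d * β - α * R) + α * α * (I * I))
      ≡⟨ solve 6 (λ g d α β R J →
           let e = g :* d :* β :- α :* R in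
           g :* (e :* e :+ α :* α :* J)
             := (g :* (α :* α) :* (R :* R :+ J) :+ g :* (β :* β) :* d :* (g :* g :* d)
                 :- (α :* β :+ α :* β) :* R :* (g :* g :* d))) refl g d α β R (I * I) ⟩
    g * (α * α) * (R * R + I * I) + g * (β * β) * d * (g * g * d) - (α * β + α * β) * R * (g * g * d)
      ≡⟨ cong (λ z → g * (α * α) * z + g * (β * β) * d * (g * g * d) - (α * β + α * β) * R * (g * g * d)) g²d ⟨
    g * (α * α) * (g * g * d) + g * (β * β) * d * (g * g * d) - (α * β + α * β) * R * (g * g * d)
      ≡⟨ solve 5 (λ u v k R h → u :* h :+ v :* h :- k :* R :* h := (u :+ v :- k :* R) :* h) refl
           (g * (α * α)) (g * (β * β) * d) (α * β + α * β) R (g * g * d) ⟩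
    (g * (α * α) + g * (β * β) * d - (α * β + α * β) * R) * (g * g * d)
      ≡⟨ cong (_* (g * g * d)) (norm-coneElement b D α β) ⟨
    norm (coneElement b D α β) * (g * g * d)
      ≤⟨ *-mono-≤-nonNeg (0≤norm (coneElement b D α β)) ℚ.≤-refl (0≤p*q (0≤p*q 0≤g 0≤g) 0≤d) (p≤p+q (0≤p² t)) ⟩
    norm (coneElement b D α β) * K ∎
    where
    open ℚ.≤-Reasoning
    open ℚ-Solver
    -- With R ≥ 0 every term of `I²` beyond t² is nonnegative.
    t²≤I² : t * t ℚ.≤ I * I
    t²≤I² = subst (t * t ℚ.≤_) (sym I²) (p≤p+q (0≤p*q 0≤t (0≤p+q (0≤p+q
      (0≤p*q (ℚ.nonNegative⁻¹ (+ 32 ℚ./ 1)) 0≤R) (0≤p*q (ℚ.nonNegative⁻¹ (+ 255 ℚ./ 1)) 0≤t))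
      (0≤p*q (ℚ.nonNegative⁻¹ (+ 32 ℚ./ 1)) (0≤p² g)))))

-- Ratios of consecutive tree weights

module LowerBound (x y : ℚ) (0<y² : 0ℚ ℚ.< y * y) where

  open Cone x y
  open TreeWeights w
  open Motzkin treeWeight b c treeWeight-0 treeWeight-1 treeWeight-suc

  private
    0<K : 0ℚ ℚ.< K
    0<K = ℚ.+-mono-≤-< (0≤p*q (0≤p*q (0≤norm b) (0≤norm b)) (0≤norm D)) (0<p*q 0<y² 0<y²)

    0<norm-c : 0ℚ ℚ.< norm c
    0<norm-c = ℚ.+-mono-≤-< (0≤p² (x + x))
      (subst (0ℚ ℚ.<_) (solve 1 (λ y → y :* y :+ y :* y :+ (y :* y :+ y :* y) := (y :+ y) :* (y :+ y)) refl y)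
        (ℚ.+-mono-< (ℚ.+-mono-< 0<y² 0<y²) (ℚ.+-mono-< 0<y² 0<y²)))
      where open ℚ-Solver

    c⁻¹ : ∃ λ v → v ⊙ c ≡ 1ℂ
    c⁻¹ = ⊙-inverse c 0<norm-c

  0<norm-coneElement : ∀ {α β} → 1ℚ ℚ.≤ α → 0ℚ ℚ.≤ β → 0ℚ ℚ.< norm (coneElement b D α β)
  0<norm-coneElement {α} {β} 1≤α 0≤β = ℚ.*-cancelʳ-<-nonNeg K {{ℚ.nonNegative (ℚ.<⇒≤ 0<K)}} (begin-strict
    0ℚ * K                             ≡⟨ ℚ.*-zeroˡ K ⟩
    0ℚ                                 <⟨ 0<p*q 0<y² (0<p*q 0<y² 0<y²) ⟩
    t * (t * t)                        ≤⟨ norm-coneElement-bound 1≤α 0≤β ⟩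
    norm (coneElement b D α β) * K     ∎)
    where open ℚ.≤-Reasoning

  -- A product equation rather than a quotient, so that it can be stated before `treeWeight m` is
  -- known to be nonzero.
  Ratio : ℕ → Set
  Ratio m = ∃ λ α → ∃ λ β → 1ℚ ℚ.≤ α × 0ℚ ℚ.≤ β ×
    treeWeight (suc m) ≡ coneElement b D α β ⊙ treeWeight m

  -- Dividing the three-term recurrence by a₁ gives ((n₃ + n₂)b - n₁D(a₀/a₁))/n₄, where a₀/a₁ =
  -- (conj z)/N. As conj z = α(conj b) - β(conj D)b, the second term adds n₁βd/N to the coefficient
  -- of b and yields n₁α/N as the new coefficient of -D(conj b), both still to be divided by n₄.
  ratio-suc : ∀ m → Ratio m → Ratio (suc m)
  ratio-suc m (α , β , 1≤α , 0≤β , a₁≡za₀) =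
    α′ , β′ , 1≤α′ , 0≤p*q (0≤p*q (0≤n·1 (1 ℕ.+ m)) 0≤α) (ℚ.<⇒≤ 0<r) , a₂≡z′a₁
    where
    0≤α : 0ℚ ℚ.≤ α
    0≤α = ℚ.≤-trans (ℚ.nonNegative⁻¹ 1ℚ) 1≤α

    z a₀ a₁ a₂ : ℚ[i]
    z  = coneElement b D α β
    a₀ = treeWeight m
    a₁ = treeWeight (1 ℕ.+ m)
    a₂ = treeWeight (2 ℕ.+ m)

    n₁ n₂ n₃ n₄ N : ℚ
    n₁ = (1 ℕ.+ m) · 1ℚ
    n₂ = (2 ℕ.+ m) · 1ℚ
    n₃ = (3 ℕ.+ m) · 1ℚ
    n₄ = (4 ℕ.+ m) · 1ℚ
    N  = norm z

    0<N : 0ℚ ℚ.< N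
    0<N = 0<norm-coneElement 1≤α 0≤β

    inverse : ∃ λ r → 0ℚ ℚ.< r × r * (n₄ * N) ≡ 1ℚ
    inverse = reciprocal (0<p*q (0<1+n·1 (3 ℕ.+ m)) 0<N)

    r : ℚ
    r = proj₁ inverse

    0<r : 0ℚ ℚ.< r
    0<r = proj₁ (proj₂ inverse)

    rn₄N≡1 : r * (n₄ * N) ≡ 1ℚ
    rn₄N≡1 = proj₂ (proj₂ inverse)

    α′ β′ : ℚ
    α′ = ((n₃ + n₂) * N + n₁ * (β * d)) * r
    β′ = n₁ * α * r

    -- Since n₃ + n₂ = n₄ + n₁, the part n₄N of the numerator already contributes 1.
    1≤α′ : 1ℚ ℚ.≤ α′
    1≤α′ = begin
      1ℚ
        ≤⟨ p≤p+q (0≤p*q (0≤p+q (0≤p*q (0≤n·1 (1 ℕ.+ m)) (ℚ.<⇒≤ 0<N))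
             (0≤p*q (0≤n·1 (1 ℕ.+ m)) (0≤p*q 0≤β (0≤norm D)))) (ℚ.<⇒≤ 0<r)) ⟩
      1ℚ + (n₁ * N + n₁ * (β * d)) * r
        ≡⟨ cong (_+ (n₁ * N + n₁ * (β * d)) * r) rn₄N≡1 ⟨
      r * (n₄ * N) + (n₁ * N + n₁ * (β * d)) * r
        ≡⟨ solve 4 (λ n₁ N e r →
             let n₂ = con 1ℚ :+ n₁
                 n₃ = con 1ℚ :+ n₂
                 n₄ = con 1ℚ :+ n₃
             in r :* (n₄ :* N) :+ (n₁ :* N :+ n₁ :* e) :* r := ((n₃ :+ n₂) :* N :+ n₁ :* e) :* r)
             refl n₁ N (β * d) r ⟩
      α′ ∎
      where
      open ℚ.≤-Reasoning
      open ℚ-Solver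

    open ≡-Reasoning
    open ℚ[i]-Solver

    -- This is a₀ = a₁/z with the denominator N cleared; it eliminates a₀ without a division by a₁.
    Na₀≡z̄a₁ : ι N ⊙ a₀ ≡ conj z ⊙ a₁
    Na₀≡z̄a₁ = begin
      ι N ⊙ a₀             ≡⟨ cong (_⊙ a₀) (conj-⊙ˡ z) ⟨
      conj z ⊙ z ⊙ a₀      ≡⟨ ⊙-assoc (conj z) z a₀ ⟩
      conj z ⊙ (z ⊙ a₀)    ≡⟨ cong (conj z ⊙_) a₁≡za₀ ⟨
      conj z ⊙ a₁          ∎

    ια′ : ι α′ ≡ ((ι n₃ ⊕ ι n₂) ⊙ ι N ⊕ ι n₁ ⊙ (ι β ⊙ (conj D ⊙ D))) ⊙ ι r
    ια′ = begin
      ι α′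
        ≡⟨ ι-* ((n₃ + n₂) * N + n₁ * (β * d)) r ⟩
      (ι ((n₃ + n₂) * N) ⊕ ι (n₁ * (β * d))) ⊙ ι r
        ≡⟨ cong₂ (λ u v → (u ⊕ v) ⊙ ι r) (ι-* (n₃ + n₂) N)
             (trans (ι-* n₁ (β * d)) (cong (ι n₁ ⊙_) (trans (ι-* β d) (cong (ι β ⊙_) (sym (conj-⊙ˡ D)))))) ⟩
      ((ι n₃ ⊕ ι n₂) ⊙ ι N ⊕ ι n₁ ⊙ (ι β ⊙ (conj D ⊙ D))) ⊙ ι r ∎

    ιβ′ : ι β′ ≡ ι n₁ ⊙ ι α ⊙ ι r
    ιβ′ = trans (ι-* (n₁ * α) r) (cong (_⊙ ι r) (ι-* n₁ α))

    ιrn₄N : ι r ⊙ (ι n₄ ⊙ ι N) ≡ 1ℂ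
    ιrn₄N = trans (cong (ι r ⊙_) (sym (ι-* n₄ N))) (trans (sym (ι-* r (n₄ * N))) (cong ι rn₄N≡1))

    a₂≡z′a₁ : a₂ ≡ coneElement b D α′ β′ ⊙ a₁
    a₂≡z′a₁ = begin
      a₂
        ≡⟨ ⊙-identityˡ a₂ ⟨
      1ℂ ⊙ a₂
        ≡⟨ cong (_⊙ a₂) ιrn₄N ⟨
      ι r ⊙ (ι n₄ ⊙ ι N) ⊙ a₂
        ≡⟨ solve 4 (λ r n N a → r :* (n :* N) :* a := r :* N :* (n :* a)) refl (ι r) (ι n₄) (ι N) a₂ ⟩
      ι r ⊙ ι N ⊙ (ι n₄ ⊙ a₂)
        ≡⟨ cong (ι r ⊙ ι N ⊙_) (three-term {proj₁ c⁻¹} (proj₂ c⁻¹) m) ⟩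
      ι r ⊙ ι N ⊙ ((ι n₃ ⊕ ι n₂) ⊙ (b ⊙ a₁) ⊕ ⊖ (ι n₁ ⊙ (D ⊙ a₀)))
        ≡⟨ solve 8 (λ r N k b a₁ n D a₀ →
             r :* N :* (k :* (b :* a₁) :+ :- (n :* (D :* a₀)))
               := r :* (k :* N :* (b :* a₁) :+ :- (n :* (D :* (N :* a₀))))) refl
             (ι r) (ι N) (ι n₃ ⊕ ι n₂) b a₁ (ι n₁) D a₀ ⟩
      ι r ⊙ ((ι n₃ ⊕ ι n₂) ⊙ ι N ⊙ (b ⊙ a₁) ⊕ ⊖ (ι n₁ ⊙ (D ⊙ (ι N ⊙ a₀))))
        ≡⟨ cong (λ u → ι r ⊙ ((ι n₃ ⊕ ι n₂) ⊙ ι N ⊙ (b ⊙ a₁) ⊕ ⊖ (ι n₁ ⊙ (D ⊙ u))))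
             (trans Na₀≡z̄a₁ (cong (_⊙ a₁) (conj-coneElement b D α β))) ⟩
      ι r ⊙ ((ι n₃ ⊕ ι n₂) ⊙ ι N ⊙ (b ⊙ a₁)
        ⊕ ⊖ (ι n₁ ⊙ (D ⊙ ((ι α ⊙ conj b ⊕ ⊖ (ι β ⊙ (conj D ⊙ b))) ⊙ a₁))))
        ≡⟨ solve 10 (λ r kN b a n D α β b̄ D̄ →
             r :* (kN :* (b :* a) :+ :- (n :* (D :* ((α :* b̄ :+ :- (β :* (D̄ :* b))) :* a))))
               := ((kN :+ n :* (β :* (D̄ :* D))) :* r :* b :+ :- (n :* α :* r :* (D :* b̄))) :* a) refl
             (ι r) ((ι n₃ ⊕ ι n₂) ⊙ ι N) b a₁ (ι n₁) D (ι α) (ι β) (conj b) (conj D) ⟩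
      (((ι n₃ ⊕ ι n₂) ⊙ ι N ⊕ ι n₁ ⊙ (ι β ⊙ (conj D ⊙ D))) ⊙ ι r ⊙ b ⊕ ⊖ (ι n₁ ⊙ ι α ⊙ ι r ⊙ (D ⊙ conj b))) ⊙ a₁
        ≡⟨ cong₂ (λ u v → (u ⊙ b ⊕ ⊖ (v ⊙ (D ⊙ conj b))) ⊙ a₁) ια′ ιβ′ ⟨
      coneElement b D α′ β′ ⊙ a₁ ∎

  ratio : ∀ m → Ratio m
  ratio zero    = 1ℚ , 0ℚ , ℚ.≤-refl , ℚ.≤-refl , (begin
    treeWeight 1
      ≡⟨ treeWeight-1 ⟩
    b
      ≡⟨ solve 2 (λ b e → b := (con 1ℂ :* b :+ :- (con 0ℂ :* e)) :* con 1ℂ) refl b (D ⊙ conj b) ⟩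
    coneElement b D 1ℚ 0ℚ ⊙ 1ℂ
      ≡⟨ cong (coneElement b D 1ℚ 0ℚ ⊙_) treeWeight-0 ⟨
    coneElement b D 1ℚ 0ℚ ⊙ treeWeight 0 ∎)
    where
    open ≡-Reasoning
    open ℚ[i]-Solver
  ratio (suc m) = ratio-suc m (ratio m)

  -- By `ratio` the weight is a product of m cone elements, each of norm at least t³/K. The bound
  -- `q` is a parameter so that one `q` can serve all late approximations of a complex number.
  norm-treeWeight-bound : ∀ {q} → 0ℚ ℚ.≤ q → q * K ℚ.≤ t * (t * t) → ∀ m → q ^ℚ m ℚ.≤ norm (treeWeight m)
  norm-treeWeight-bound 0≤q qK≤t³ zero    = ℚ.≤-reflexive (sym (cong norm treeWeight-0))
  norm-treeWeight-bound {q} 0≤q qK≤t³ (suc m) with α , β , 1≤α , 0≤β , a₁≡za₀ ← ratio m = begin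
    q * q ^ℚ m                                      ≤⟨ *-mono-≤-nonNeg 0≤q q≤N (0≤q^ m) (norm-treeWeight-bound 0≤q qK≤t³ m) ⟩
    norm (coneElement b D α β) * norm (treeWeight m) ≡⟨ norm-⊙ (coneElement b D α β) (treeWeight m) ⟨
    norm (coneElement b D α β ⊙ treeWeight m)        ≡⟨ cong norm a₁≡za₀ ⟨
    norm (treeWeight (suc m))                        ∎
    where
    open ℚ.≤-Reasoning
    0≤q^ : ∀ n → 0ℚ ℚ.≤ q ^ℚ n
    0≤q^ zero    = ℚ.nonNegative⁻¹ 1ℚ
    0≤q^ (suc n) = 0≤p*q 0≤q (0≤q^ n)
    q≤N : q ℚ.≤ norm (coneElement b D α β)
    q≤N = ℚ.*-cancelʳ-≤-pos K {{ℚ.positive 0<K}} (ℚ.≤-trans qK≤t³ (norm-coneElement-bound 1≤α 0≤β))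

-- Passage from rational approximations to complex roots

p≤∣p∣ : ∀ p → p ℚ.≤ ∣ p ∣
p≤∣p∣ p with ℚ.≤-total 0ℚ p
... | inj₁ 0≤p = ℚ.≤-reflexive (sym (ℚ.0≤p⇒∣p∣≡p 0≤p))
... | inj₂ p≤0 = ℚ.≤-trans p≤0 (ℚ.0≤∣p∣ p)

∣p∣*∣p∣≡p*p : ∀ p → ∣ p ∣ * ∣ p ∣ ≡ p * p
∣p∣*∣p∣≡p*p p = trans (sym (ℚ.∣p*q∣≡∣p∣*∣q∣ p p)) (ℚ.0≤p⇒∣p∣≡p (0≤p² p))

eventually-bounded : ∀ x → ∃ λ N → ∃ λ B → 0ℚ ℚ.< B × (∀ k → N ≤ k → seq x k ℚ.≤ B)
eventually-bounded x with N , close ← cauchy x 1ℚ (ℚ.positive⁻¹ 1ℚ) =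
  N , 1ℚ + ∣ seq x N ∣ , ℚ.+-mono-<-≤ (ℚ.positive⁻¹ 1ℚ) (ℚ.0≤∣p∣ (seq x N)) , λ k N≤k → begin
    seq x k                            ≡⟨ solve 2 (λ a b → a := (a :- b) :+ b) refl (seq x k) (seq x N) ⟩
    (seq x k - seq x N) + seq x N      ≤⟨ ℚ.+-mono-≤ (p≤∣p∣ (seq x k - seq x N)) (p≤∣p∣ (seq x N)) ⟩
    ∣ seq x k - seq x N ∣ + ∣ seq x N ∣ ≤⟨ ℚ.+-monoˡ-≤ ∣ seq x N ∣ (ℚ.<⇒≤ (close k N N≤k ℕ.≤-refl)) ⟩
    1ℚ + ∣ seq x N ∣                   ∎
  where
  open ℚ.≤-Reasoning
  open ℚ-Solver

≃-refl : ∀ x → x ≃ x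
≃-refl x ε 0<ε = 0 , λ k _ → subst (λ p → ∣ p ∣ ℚ.< ε) (sym (ℚ.+-inverseʳ (seq x k))) 0<ε

-- Once |p| is at most 1, p² is at most |p|.
≃0⇒square-small : ∀ x → x ≃ 0ℝ → ∀ ε → 0ℚ ℚ.< ε → ∃ λ N → ∀ k → N ≤ k → seq x k * seq x k ℚ.< ε
≃0⇒square-small x x≃0 ε 0<ε
  with M , below-ε ← x≃0 ε 0<ε
  with N , below-1 ← x≃0 1ℚ (ℚ.positive⁻¹ 1ℚ) = M ℕ.⊔ N , λ k M⊔N≤k →
  let p = seq x k in begin-strict
    p * p                    ≡⟨ solve 1 (λ p → p :* p := (p :- con 0ℚ) :* (p :- con 0ℚ)) refl p ⟩
    (p - 0ℚ) * (p - 0ℚ)      ≡⟨ ∣p∣*∣p∣≡p*p (p - 0ℚ) ⟨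
    ∣ p - 0ℚ ∣ * ∣ p - 0ℚ ∣  ≤⟨ *-mono-≤-nonNeg (ℚ.0≤∣p∣ (p - 0ℚ)) ℚ.≤-refl (ℚ.0≤∣p∣ (p - 0ℚ))
                                  (ℚ.<⇒≤ (below-1 k (ℕ.m⊔n≤o⇒n≤o M N M⊔N≤k))) ⟩
    ∣ p - 0ℚ ∣ * 1ℚ          ≡⟨ ℚ.*-identityʳ ∣ p - 0ℚ ∣ ⟩
    ∣ p - 0ℚ ∣               <⟨ below-ε k (ℕ.m⊔n≤o⇒m≤o M N M⊔N≤k) ⟩
    ε                        ∎
  where
  open ℚ.≤-Reasoning
  open ℚ-Solver

normℝ : ℂ → ℝ
normℝ z = re z *ℝ re z +ℝ im z *ℝ im z

-- Its approximations are definitionally the values of Cone.K at the approximations of z.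
coneBound : ℂ → ℝ
coneBound z = normℝ b *ℝ normℝ b *ℝ normℝ D +ℝ (im z *ℝ im z) *ℝ (im z *ℝ im z)
  where
  b c 4c D : ℂ
  b  = ofℝ (fromℚ 1ℚ) +ℂ z
  c  = z +ℂ z
  4c = c +ℂ c +ℂ (c +ℂ c)
  D  = b *ℂ b +ℂ ((-ℝ re 4c) +i (-ℝ im 4c))

module _ (m : ℕ) (z P : ℂ)
         (P≡zT : ∀ k → at P k ≡ at z k ⊙ TreeWeights.treeWeight (at z k) m)
         (root : P ≃ℂ ofℝ 0ℝ) where

  -- If a late approximation had imaginary part at least ε in modulus, the norm of `P` there would
  -- be at least a positive η independent of k, although `P` tends to 0.
  im≃0 : im z ≃ 0ℝ
  im≃0 ε 0<ε = N , below
    where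
    open ℚ.≤-Reasoning
    open ℚ-Solver
    bound : ∃ λ N → ∃ λ B → 0ℚ ℚ.< B × (∀ k → N ≤ k → seq (coneBound z) k ℚ.≤ B)
    bound = eventually-bounded (coneBound z)

    B : ℚ
    B = proj₁ (proj₂ bound)

    inverse : ∃ λ r → 0ℚ ℚ.< r × r * B ≡ 1ℚ
    inverse = reciprocal (proj₁ (proj₂ (proj₂ bound)))

    -- `q` is ε⁶/B, so that y² ≥ ε² and K ≤ B give qK ≤ y⁶. Then `η` bounds the norm of w times the
    -- tree weight from below, the factor ε² coming from norm w ≥ y² ≥ ε².
    B⁻¹ ε² q η : ℚ
    B⁻¹ = proj₁ inverse
    ε² = ε * ε
    q  = ε² * (ε² * ε²) * B⁻¹
    η  = ε² * q ^ℚ m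

    0<ε² : 0ℚ ℚ.< ε²
    0<ε² = 0<p*q 0<ε 0<ε

    0<q : 0ℚ ℚ.< q
    0<q = 0<p*q (0<p*q 0<ε² (0<p*q 0<ε² 0<ε²)) (proj₁ (proj₂ inverse))

    0<q^ : ∀ n → 0ℚ ℚ.< q ^ℚ n
    0<q^ zero    = ℚ.positive⁻¹ 1ℚ
    0<q^ (suc n) = 0<p*q 0<q (0<q^ n)

    0<½η : 0ℚ ℚ.< ½ * η
    0<½η = 0<p*q (ℚ.positive⁻¹ ½) (0<p*q 0<ε² (0<q^ m))

    small-re : ∃ λ N → ∀ k → N ≤ k → seq (re P) k * seq (re P) k ℚ.< ½ * η
    small-re = ≃0⇒square-small (re P) (proj₁ root) (½ * η) 0<½η

    small-im : ∃ λ N → ∀ k → N ≤ k → seq (im P) k * seq (im P) k ℚ.< ½ * η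
    small-im = ≃0⇒square-small (im P) (proj₂ root) (½ * η) 0<½η

    N₀ N₁ N₂ N : ℕ
    N₀ = proj₁ bound
    N₁ = proj₁ small-re
    N₂ = proj₁ small-im
    N  = N₀ ℕ.⊔ (N₁ ℕ.⊔ N₂)

    module _ (k : ℕ) (N≤k : N ≤ k) where

      private
        x y : ℚ
        x = seq (re z) k
        y = seq (im z) k
      open Cone x y using (w; K)
      open TreeWeights w using (treeWeight)

      norm-P<η : norm (at P k) ℚ.< η
      norm-P<η = begin-strict
        norm (at P k)      <⟨ ℚ.+-mono-<
                                (proj₂ small-re k (ℕ.m⊔n≤o⇒m≤o N₁ N₂ (ℕ.m⊔n≤o⇒n≤o N₀ _ N≤k)))
                                (proj₂ small-im k (ℕ.m⊔n≤o⇒n≤o N₁ N₂ (ℕ.m⊔n≤o⇒n≤o N₀ _ N≤k))) ⟩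
        ½ * η + ½ * η      ≡⟨ solve 1 (λ η → con ½ :* η :+ con ½ :* η := η) refl η ⟩
        η                  ∎

      η≤norm-P : ε ℚ.≤ ∣ y - 0ℚ ∣ → η ℚ.≤ norm (at P k)
      η≤norm-P ε≤∣y∣ = begin
        ε² * q ^ℚ m                  ≤⟨ *-mono-≤-nonNeg (ℚ.<⇒≤ 0<ε²) (ℚ.≤-trans ε²≤y² (p≤q+p (0≤p² x)))
                                          (ℚ.<⇒≤ (0<q^ m))
                                          (LowerBound.norm-treeWeight-bound x y 0<y² (ℚ.<⇒≤ 0<q) qK≤y⁶ m) ⟩
        norm w * norm (treeWeight m) ≡⟨ norm-⊙ w (treeWeight m) ⟨
        norm (w ⊙ treeWeight m)      ≡⟨ cong norm (P≡zT k) ⟨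
        norm (at P k)                ∎
        where
        ε²≤y² : ε² ℚ.≤ y * y
        ε²≤y² = begin
          ε * ε                    ≤⟨ *-mono-≤-nonNeg (ℚ.<⇒≤ 0<ε) ε≤∣y∣ (ℚ.<⇒≤ 0<ε) ε≤∣y∣ ⟩
          ∣ y - 0ℚ ∣ * ∣ y - 0ℚ ∣  ≡⟨ ∣p∣*∣p∣≡p*p (y - 0ℚ) ⟩
          (y - 0ℚ) * (y - 0ℚ)      ≡⟨ solve 1 (λ y → (y :- con 0ℚ) :* (y :- con 0ℚ) := y :* y) refl y ⟩
          y * y                    ∎
        0<y² : 0ℚ ℚ.< y * y
        0<y² = ℚ.<-≤-trans 0<ε² ε²≤y²
        qK≤y⁶ : q * K ℚ.≤ y * y * (y * y * (y * y))
        qK≤y⁶ = begin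
          q * K
            ≤⟨ ℚ.*-monoˡ-≤-nonNeg q {{ℚ.nonNegative (ℚ.<⇒≤ 0<q)}} (proj₂ (proj₂ (proj₂ bound)) k (ℕ.m⊔n≤o⇒m≤o N₀ _ N≤k)) ⟩
          ε² * (ε² * ε²) * B⁻¹ * B
            ≡⟨ trans (ℚ.*-assoc (ε² * (ε² * ε²)) B⁻¹ B) (cong (ε² * (ε² * ε²) *_) (proj₂ (proj₂ inverse))) ⟩
          ε² * (ε² * ε²) * 1ℚ
            ≡⟨ ℚ.*-identityʳ (ε² * (ε² * ε²)) ⟩
          ε² * (ε² * ε²)
            ≤⟨ *-mono-≤-nonNeg (ℚ.<⇒≤ 0<ε²) ε²≤y² (ℚ.<⇒≤ (0<p*q 0<ε² 0<ε²))
                 (*-mono-≤-nonNeg (ℚ.<⇒≤ 0<ε²) ε²≤y² (ℚ.<⇒≤ 0<ε²) ε²≤y²) ⟩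
          y * y * (y * y * (y * y)) ∎

      below : ∣ y - 0ℚ ∣ ℚ.< ε
      -- The order of ℚ is decidable, which makes the argument by contradiction constructive.
      below = decidable-stable (∣ y - 0ℚ ∣ ℚ.<? ε) (λ ∣y∣≮ε →
        ℚ.<-irrefl refl (ℚ.<-≤-trans norm-P<η (η≤norm-P (ℚ.≮⇒≥ ∣y∣≮ε))))

theorem5p1 : (n : ℕ) → 1 ≤ n → RealRootsOnly (BoNaPoly n)
-- The real number is the real part of `z`; trees with n = m + 1 vertices have m edges.
theorem5p1 (suc m) (s≤s _) z root = re z , ≃-refl (re z) ,
  im≃0 m z (eval (BoNaPoly (suc m)) z) (at-BoNaPoly m z) root
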